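{- Let $G$ be a connected nontrivial graph with $m$ vertices and let $n\geq 2$. Then $$\lambda'(G\boxtimes P_n)=\min\{(3n-2)\lambda(G),\ m+2e(G),\ 2\xi(G)+4,\ 5\delta(G)+1\}.$$
   Context: All graphs are finite, simple and undirected; "nontrivial" means having at least two vertices. $P_n$, $C_n$, $K_n$ denote the path, cycle and complete graph on $n$ vertices. For a graph $G$: $e(G)=|E(G)|$; $\delta(G)$ is the minimum degree; $\lambda(G)$ is the edge-connectivity (minimum size of an edge set whose removal disconnects $G$); for an edge $uv$, its edge-degree is $d_G(u)+d_G(v)-2$, and $\xi(G)$ is the minimum edge-degree over all edges of $G$. A restricted edge-cut of a connected graph $G$ is a set $S\subseteq E(G)$ such that $G-S$ is disconnected and every component of $G-S$ has at least $2$ vertices; the restricted edge-connectivity $\lambda'(G)$ is the minimum cardinality of a restricted edge-cut (it exists, e.g., whenever $G$ has at least four vertices and is not a star, and then $\lambda'(G)\le\xi(G)$). The strong product $G\boxtimes H$ has vertex set $V(G)\times V(H)$, with $(x_1,y_1)$ and $(x_2,y_2)$ adjacent iff either $x_1=x_2$ and $y_1y_2\in E(H)$, or $y_1=y_2$ and $x_1x_2\in E(G)$, or $x_1x_2\in E(G)$ and $y_1y_2\in E(H)$. -}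

module Defs where

open import Level using (Level; _⊔_)
open import Data.Fin using (Fin; toℕ)
import Data.Fin as Fin
import Data.Fin.Properties as Fin
open import Data.List using (List; length; filter; map; allFin; cartesianProduct)
open import Data.Nat using (ℕ; suc; _+_; _*_; _∸_; _≤_; _≟_)
open import Data.Nat.Properties using (1+n≢n)
open import Data.Product using (∃; ∃₂; _×_; _,_; proj₁; uncurry)
open import Data.Product.Function.NonDependent.Propositional using (_×-↔_)
open import Data.Sum using (_⊎_; inj₁; inj₂; swap)
open import Data.Unit using (⊤)
open import Function using (_∘_; _↔_; Inverse)
open import Function.Construct.Composition using (_↔-∘_)
open import Function.Construct.Identity using (↔-id)
open import Function.Construct.Symmetry using (↔-sym)
open import Function.Properties.Inverse using (↔⇒↣)
open import Relation.Binary using (Decidable; Symmetric; Irreflexive; DecidableEquality)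
open import Relation.Binary.Construct.Closure.ReflexiveTransitive using (Star)
open import Relation.Binary.PropositionalEquality using (_≡_; _≢_; refl; sym)
open import Relation.Nullary using (¬_)
open import Relation.Nullary.Decidable using (_×-dec_; _⊎-dec_; ¬?; via-injection)

record Graph : Set₁ where
  field
    V      : Set
    order  : ℕ
    enum   : V ↔ Fin order
    Adj    : V → V → Set
    adj?   : Decidable Adj
    sym-Adj    : Symmetric Adj
    irrefl-Adj : Irreflexive _≡_ Adj

  index : V → Fin order
  index = Inverse.to enum

  _≟ⱽ_ : DecidableEquality V
  _≟ⱽ_ = via-injection (↔⇒↣ enum) Fin._≟_

  vertices : List V
  vertices = map (Inverse.from enum) (allFin order)

  -- Each edge uv is listed exactly once, as the ordered pair with index u < index v.
  edges : List (V × V)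
  edges = filter (λ (u , v) → (index u Fin.<? index v) ×-dec adj? u v)
                 (cartesianProduct vertices vertices)

  e : ℕ
  e = length edges

  degree : V → ℕ
  degree u = length (filter (adj? u) vertices)

  -- For an edge uv both degrees are at least 1, so the subtraction does not truncate.
  edgeDegree : V × V → ℕ
  edgeDegree (u , v) = degree u + degree v ∸ 2

  Connected : Set
  Connected = ∀ u v → Star Adj u v

  -- The component containing v, as a predicate on vertices.
  Component : V → V → Set
  Component v w = Star Adj v w

  Nontrivial : Set
  Nontrivial = 2 ≤ order

-- A subset of E(G), given by a symmetric membership relation on the end-vertices.
record EdgeSet (G : Graph) : Set₁ where
  open Graph G
  field
    Mem     : V → V → Set
    mem?    : Decidable Mem
    sym-Mem : Symmetric Mem
    Mem⊆Adj : ∀ {u v} → Mem u v → Adj u v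

  size : ℕ
  size = length (filter (uncurry mem?) edges)

_−_ : (G : Graph) → EdgeSet G → Graph
G − S = record
  { V          = V
  ; order      = order
  ; enum       = enum
  ; Adj        = λ u v → Adj u v × ¬ Mem u v
  ; adj?       = λ u v → adj? u v ×-dec ¬? (mem? u v)
  ; sym-Adj    = λ (a , s) → sym-Adj a , s ∘ sym-Mem
  ; irrefl-Adj = λ u≡v → irrefl-Adj u≡v ∘ proj₁
  }
  where open Graph G; open EdgeSet S

AtLeastTwo : {A : Set} → (A → Set) → Set
AtLeastTwo P = ∃₂ λ x y → P x × P y × x ≢ y

-- k is the (attained) minimum of f over the elements satisfying P.
IsMinimumOf : {a p : Level} {A : Set a} → (A → ℕ) → (A → Set p) → ℕ → Set (a ⊔ p)
IsMinimumOf f P k = (∃ λ x → P x × f x ≡ k) × (∀ x → P x → k ≤ f x)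

IsEdgeCut : (G : Graph) → EdgeSet G → Set
IsEdgeCut G S = ¬ Graph.Connected (G − S)

IsRestrictedEdgeCut : (G : Graph) → EdgeSet G → Set
IsRestrictedEdgeCut G S =
  ¬ Graph.Connected (G − S) × (∀ v → AtLeastTwo (Graph.Component (G − S) v))

IsMinDegree : Graph → ℕ → Set
IsMinDegree G = IsMinimumOf (Graph.degree G) (λ _ → ⊤)

IsMinEdgeDegree : Graph → ℕ → Set
IsMinEdgeDegree G = IsMinimumOf (Graph.edgeDegree G) (uncurry (Graph.Adj G))

IsEdgeConnectivity : Graph → ℕ → Set₁
IsEdgeConnectivity G = IsMinimumOf EdgeSet.size (IsEdgeCut G)

IsRestrictedEdgeConnectivity : Graph → ℕ → Set₁
IsRestrictedEdgeConnectivity G = IsMinimumOf EdgeSet.size (IsRestrictedEdgeCut G)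

Path : ℕ → Graph
Path n = record
  { V          = Fin n
  ; order      = n
  ; enum       = ↔-id (Fin n)
  ; Adj        = λ i j → suc (toℕ i) ≡ toℕ j ⊎ suc (toℕ j) ≡ toℕ i
  ; adj?       = λ i j → (suc (toℕ i) ≟ toℕ j) ⊎-dec (suc (toℕ j) ≟ toℕ i)
  ; sym-Adj    = swap
  ; irrefl-Adj = λ { refl (inj₁ p) → 1+n≢n p ; refl (inj₂ p) → 1+n≢n p }
  }

_⊠_ : Graph → Graph → Graph
G ⊠ H = record
  { V          = G.V × H.V
  ; order      = G.order * H.order
  ; enum       = ↔-sym Fin.*↔× ↔-∘ (G.enum ×-↔ H.enum)
  ; Adj        = λ (x₁ , y₁) (x₂ , y₂) →
                   (x₁ ≡ x₂ × H.Adj y₁ y₂) ⊎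
                   (y₁ ≡ y₂ × G.Adj x₁ x₂) ⊎
                   (G.Adj x₁ x₂ × H.Adj y₁ y₂)
  ; adj?       = λ (x₁ , y₁) (x₂ , y₂) →
                   ((x₁ G.≟ⱽ x₂) ×-dec H.adj? y₁ y₂) ⊎-dec
                   ((y₁ H.≟ⱽ y₂) ×-dec G.adj? x₁ x₂) ⊎-dec
                   (G.adj? x₁ x₂ ×-dec H.adj? y₁ y₂)
  ; sym-Adj    = λ { (inj₁ (p , q))        → inj₁ (sym p , H.sym-Adj q)
                   ; (inj₂ (inj₁ (p , q))) → inj₂ (inj₁ (sym p , G.sym-Adj q))
                   ; (inj₂ (inj₂ (p , q))) → inj₂ (inj₂ (G.sym-Adj p , H.sym-Adj q)) }
  ; irrefl-Adj = λ { refl (inj₁ (_ , q))        → H.irrefl-Adj refl q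
                   ; refl (inj₂ (inj₁ (_ , q))) → G.irrefl-Adj refl q
                   ; refl (inj₂ (inj₂ (p , _))) → G.irrefl-Adj refl p }
  }
  where module G = Graph G; module H = Graph H

{-# OPTIONS --safe #-}
module Submission where

-- A restricted edge cut contains the boundary of a vertex set A such that A and its complement each
-- span an edge. Let A_i be the layers of A. With w(X) = Σ_{x ∈ X} (deg x + 1) and c(X, Y) the number of
-- edges between consecutive layers that join X to the complement of Y or Y to that of X, the boundary has size
-- Σ ∂A_i + Σ c(A_i, A_{i+1}), and c satisfies
--   c(X, Y) ≥ |w(X) − w(Y)|,
--   c(X, Y) ≥ |X Δ Y| + ∂(X ∩ Y) + ∂(X ∪ Y),
--   c(X, Y) ≥ w(X) + w(Y) − 2|X||Y|.
-- If every layer is nonempty and proper, the last two give c(A_i, A_{i+1}) ≥ 2λ unless the two layers are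
-- complementary, in which case ∂A_i + ∂A_{i+1} + c(A_i, A_{i+1}) ≥ m + 2e. If some layer is empty,
-- telescoping the first inequality towards it yields w(X) + ∂X ≥ 2ξ + 4 from a layer X containing an edge,
-- and 5δ + 1 from two consecutive nonempty independent layers; a full layer is an empty one of the complement.
-- The four values are attained by B × P_n for a minimum cut ∂B of G, an end layer, an edge of an
-- end layer, and {x} × (the first two layers).

open import Defs
import Data.Bool as Bool
open import Data.Bool using (Bool; true; false; T; _∧_; _∨_; not; _xor_)
open import Data.Bool.Properties using (∧-zeroʳ; ∧-identityʳ; ∨-zeroʳ; xor-comm; xor-same; not-involutive; xor-identityʳ)
open import Data.Fin using (Fin; zero; suc; toℕ; inject₁; combine; _↑ˡ_; _↑ʳ_; _≟_)
import Data.Fin.Properties as Fin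
open import Data.Empty using (⊥; ⊥-elim)
import Data.Nat as ℕ
open import Data.Nat using (ℕ; zero; suc; _+_; _*_; _∸_; _⊓_; _≤_; z≤n; s≤s; _≤?_)
open import Data.Nat.Properties hiding (_≟_)
open import Data.Nat.Tactic.RingSolver using (solve-∀)
open import Algebra.Properties.Semiring.Sum +-*-semiring using (sum; sum-cong-≗; ∑-distrib-+; ∑-comm; sum-replicate-zero; *-distribˡ-sum; *-distribʳ-sum)
open import Data.Fin.Subset using (Subset)
open import Data.Fin.Subset.Properties using (anySubset?)
import Data.Vec as Vec
open import Data.Vec using (lookup)
open import Data.Vec.Properties using (lookup∘tabulate)
open import Data.List using ([]; _∷_; _++_; length; filter; map; tabulate; cartesianProduct)
open import Data.List.Properties using (map-tabulate; filter-++; length-++)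
open import Data.Product using (∃; _×_; _,_; proj₁; proj₂; uncurry)
import Data.Sum as Sum
open import Data.Sum using (_⊎_; inj₁; inj₂)
open import Effect.Monad using (RawMonad)
open import Function using (_∘_; id; mk⇔; Inverse)
open import Relation.Binary using (tri<; tri≈; tri>)
open import Relation.Binary.Construct.Closure.ReflexiveTransitive using (Star; ε; _◅_; _◅◅_)
open import Relation.Binary.PropositionalEquality using (_≡_; _≢_; refl; sym; trans; cong; cong₂; subst; subst₂; module ≡-Reasoning)
open import Relation.Nullary using (¬_; Dec; yes; no; does; contradiction)
open import Relation.Nullary.Negation using (¬¬-map; ¬¬-Monad)
open import Relation.Nullary.Decidable using (map′; does-⇔; _×-dec_; _⊎-dec_; toWitness; T?; decidable-stable; ¬¬-excluded-middle; dec-true; dec-false)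

-- Finite sums and Boolean indicators.

⟦_⟧ : Bool → ℕ
⟦ true ⟧  = 1
⟦ false ⟧ = 0

∀Bool? : {P : Bool → Set} → (∀ b → Dec (P b)) → Dec (∀ b → P b)
∀Bool? P? = map′ (λ { (t , f) true → t ; (t , f) false → f }) (λ h → h true , h false)
                 (P? true ×-dec P? false)

sum-mono : ∀ {n} {f g : Fin n → ℕ} → (∀ i → f i ≤ g i) → sum f ≤ sum g
sum-mono {zero}  f≤g = z≤n
sum-mono {suc n} f≤g = +-mono-≤ (f≤g zero) (sum-mono (f≤g ∘ suc))

sum-const : ∀ n k → sum {n} (λ _ → k) ≡ n * k
sum-const zero    k = refl
sum-const (suc n) k = cong (k +_) (sum-const n k)

sum-≡0 : ∀ {n} {f : Fin n → ℕ} → (∀ i → f i ≡ 0) → sum f ≡ 0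
sum-≡0 {n} f≡0 = trans (sum-cong-≗ f≡0) (sum-replicate-zero n)

term≤sum : ∀ {n} (f : Fin n → ℕ) i → f i ≤ sum f
term≤sum f zero    = m≤m+n _ _
term≤sum f (suc i) = ≤-trans (term≤sum (f ∘ suc) i) (m≤n+m _ (f zero))

two-terms≤sum : ∀ {n} (f : Fin n → ℕ) {i j} → i ≢ j → f i + f j ≤ sum f
two-terms≤sum f {zero}  {zero}  i≢j = contradiction refl i≢j
two-terms≤sum f {zero}  {suc j} i≢j = +-monoʳ-≤ (f zero) (term≤sum (f ∘ suc) j)
two-terms≤sum f {suc i} {zero}  i≢j =
  subst (_≤ sum f) (+-comm (f zero) _) (+-monoʳ-≤ (f zero) (term≤sum (f ∘ suc) i))
two-terms≤sum f {suc i} {suc j} i≢j =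
  ≤-trans (two-terms≤sum (f ∘ suc) (i≢j ∘ cong suc)) (m≤n+m _ (f zero))

sum-δ-* : ∀ {n} (i : Fin n) (f : Fin n → ℕ) → sum (λ j → ⟦ does (i ≟ j) ⟧ * f j) ≡ f i
sum-δ-* {suc n} zero    f = trans (cong₂ _+_ (+-identityʳ (f zero)) (sum-≡0 {n} (λ _ → refl))) (+-identityʳ _)
sum-δ-* {suc n} (suc i) f = sum-δ-* i (f ∘ suc)

⟦∧⟧ : ∀ p q → ⟦ p ∧ q ⟧ ≡ ⟦ p ⟧ * ⟦ q ⟧
⟦∧⟧ true  q = sym (+-identityʳ _)
⟦∧⟧ false q = refl

sum-δ : ∀ {n} (i : Fin n) (f : Fin n → Bool) → sum (λ j → ⟦ does (i ≟ j) ∧ f j ⟧) ≡ ⟦ f i ⟧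
sum-δ i f = trans (sum-cong-≗ (λ j → ⟦∧⟧ (does (i ≟ j)) (f j))) (sum-δ-* i (⟦_⟧ ∘ f))

sum-++ : ∀ m {n} (f : Fin (m + n) → ℕ) → sum f ≡ sum (λ i → f (i ↑ˡ n)) + sum (λ j → f (m ↑ʳ j))
sum-++ zero    f = refl
sum-++ (suc m) f = trans (cong (f zero +_) (sum-++ m (f ∘ suc))) (sym (+-assoc (f zero) _ _))

sum-combine : ∀ m {n} (f : Fin (m * n) → ℕ) → sum f ≡ sum (λ i → sum (λ j → f (combine {m} {n} i j)))
sum-combine zero        f = refl
sum-combine (suc m) {n} f = trans (sum-++ n f) (cong (sum (λ j → f (j ↑ˡ (m * n))) +_) (sum-combine m _))

sum₂ : ∀ {m n} → (Fin m → Fin n → ℕ) → ℕ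
sum₂ f = sum (λ i → sum (f i))

sum₂-mono : ∀ {m n} {f g : Fin m → Fin n → ℕ} → (∀ i j → f i j ≤ g i j) → sum₂ f ≤ sum₂ g
sum₂-mono f≤g = sum-mono (λ i → sum-mono (f≤g i))

sum₂-cong : ∀ {m n} {f g : Fin m → Fin n → ℕ} → (∀ i j → f i j ≡ g i j) → sum₂ f ≡ sum₂ g
sum₂-cong f≡g = sum-cong-≗ (λ i → sum-cong-≗ (f≡g i))

sum₂-+ : ∀ {m n} (f g : Fin m → Fin n → ℕ) → sum₂ (λ i j → f i j + g i j) ≡ sum₂ f + sum₂ g
sum₂-+ f g = trans (sum-cong-≗ (λ i → ∑-distrib-+ (f i) (g i))) (∑-distrib-+ (sum ∘ f) (sum ∘ g))

sum₂-double : ∀ {n} (f : Fin n → Fin n → ℕ) → sum₂ (λ i j → f i j + f j i) ≡ 2 * sum₂ f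
sum₂-double f = trans (sum₂-+ f (λ i j → f j i))
  (cong (sum₂ f +_) (trans (sym (∑-comm f)) (sym (+-identityʳ _))))

-- Transposing does not change a double sum, so the two orders of a pair may be compared together,
-- even where the comparison fails for one order alone.
sum₂-mono-sym : ∀ {n} {f g : Fin n → Fin n → ℕ} →
  (∀ i j → f i j + f j i ≤ g i j + g j i) → sum₂ f ≤ sum₂ g
sum₂-mono-sym {f = f} {g} h = *-cancelˡ-≤ 2
  (subst (_≤ 2 * sum₂ g) (sum₂-double f)
    (subst (sum₂ (λ i j → f i j + f j i) ≤_) (sum₂-double g) (sum₂-mono h)))

∣_∣ : ∀ {n} → (Fin n → Bool) → ℕ
∣ X ∣ = sum (λ x → ⟦ X x ⟧)

nonempty⇒1≤∣∣ : ∀ {n} {X : Fin n → Bool} → ∃ (λ x → X x ≡ true) → 1 ≤ ∣ X ∣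
nonempty⇒1≤∣∣ {X = X} (x , Xx) = subst (λ b → ⟦ b ⟧ ≤ ∣ X ∣) Xx (term≤sum _ x)

-- Consecutive indices and telescoping.

inject₁≢suc : ∀ {n} (i : Fin n) → inject₁ i ≢ suc i
inject₁≢suc (suc i) e = inject₁≢suc i (Fin.suc-injective e)

-- Consecutive indices of Fin (suc n) are written inject₁ i and suc i.
links : ∀ {n} → (Fin (suc n) → Fin (suc n) → ℕ) → ℕ
links g = sum (λ i → g (inject₁ i) (suc i))

-- On the walk from `p` to `q` each link crossed costs at most its `g`, and the remaining links only
-- enlarge the bound. Links are crossed in either direction, hence the hypotheses for both orders of
-- the arguments of `g`.
telescope : ∀ {n} (g : Fin (suc n) → Fin (suc n) → ℕ) (w : Fin (suc n) → ℕ) →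
  (∀ i j → w i ≤ w j + g i j) → (∀ i j → w i ≤ w j + g j i) →
  ∀ p q → w p ≤ w q + links g
telescope         g w up dn zero    zero    = m≤m+n _ _
telescope {suc n} g w up dn zero    (suc q) = begin
  w zero                               ≤⟨ up zero (suc zero) ⟩
  w (suc zero) + g₀                    ≤⟨ +-monoˡ-≤ g₀ (telescope g′ (w ∘ suc) (λ _ _ → up _ _) (λ _ _ → dn _ _) zero q) ⟩
  w (suc q) + links g′ + g₀            ≡⟨ +-assoc (w (suc q)) _ _ ⟩
  w (suc q) + (links g′ + g₀)          ≡⟨ cong (w (suc q) +_) (+-comm (links g′) g₀) ⟩
  w (suc q) + links g                  ∎
  where
  open ≤-Reasoning
  g′ = λ i j → g (suc i) (suc j)
  g₀ = g zero (suc zero)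
telescope {suc n} g w up dn (suc p) zero    = begin
  w (suc p)                            ≤⟨ telescope g′ (w ∘ suc) (λ _ _ → up _ _) (λ _ _ → dn _ _) p zero ⟩
  w (suc zero) + links g′              ≤⟨ +-monoˡ-≤ _ (dn (suc zero) zero) ⟩
  w zero + g₀ + links g′               ≡⟨ +-assoc (w zero) _ _ ⟩
  w zero + links g                     ∎
  where
  open ≤-Reasoning
  g′ = λ i j → g (suc i) (suc j)
  g₀ = g zero (suc zero)
telescope {suc n} g w up dn (suc p) (suc q) =
  ≤-trans (telescope (λ i j → g (suc i) (suc j)) (w ∘ suc) (λ _ _ → up _ _) (λ _ _ → dn _ _) p q)
          (+-monoʳ-≤ (w (suc q)) (m≤n+m _ _))

-- Going from the link between inject₁ i and suc i to q, one of the two ends of the link is left first.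
telescope-link : ∀ {n} (g : Fin (suc n) → Fin (suc n) → ℕ) (w : Fin (suc n) → ℕ) →
  (∀ i j → w i ≤ w j + g i j) → (∀ i j → w i ≤ w j + g j i) →
  ∀ i q → (g (inject₁ i) (suc i) + w (inject₁ i) ≤ w q + links g) ⊎
          (g (inject₁ i) (suc i) + w (suc i) ≤ w q + links g)
telescope-link {suc n} g w up dn zero zero = inj₁ (begin
  g₀ + w zero            ≡⟨ +-comm g₀ _ ⟩
  w zero + g₀            ≤⟨ +-monoʳ-≤ (w zero) (m≤m+n _ _) ⟩
  w zero + links g       ∎)
  where
  open ≤-Reasoning
  g₀ = g zero (suc zero)
telescope-link {suc n} g w up dn zero (suc q) = inj₂ (begin
  g₀ + w (suc zero)             ≤⟨ +-monoʳ-≤ g₀ (telescope g′ (w ∘ suc) (λ _ _ → up _ _) (λ _ _ → dn _ _) zero q) ⟩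
  g₀ + (w (suc q) + links g′)   ≡⟨ swap g₀ (w (suc q)) (links g′) ⟩
  w (suc q) + links g           ∎)
  where
  open ≤-Reasoning
  g′ = λ i j → g (suc i) (suc j)
  g₀ = g zero (suc zero)
  swap : ∀ a b c → a + (b + c) ≡ b + (a + c)
  swap = solve-∀
telescope-link {suc n} g w up dn (suc i) zero = Sum.map step step
    (telescope-link g′ (w ∘ suc) (λ _ _ → up _ _) (λ _ _ → dn _ _) i zero)
  where
  open ≤-Reasoning
  g′ = λ i j → g (suc i) (suc j)
  g₀ = g zero (suc zero)
  step : ∀ {k} → k ≤ w (suc zero) + links g′ → k ≤ w zero + links g
  step {k} h = begin
    k                           ≤⟨ h ⟩
    w (suc zero) + links g′     ≤⟨ +-monoˡ-≤ _ (dn (suc zero) zero) ⟩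
    w zero + g₀ + links g′      ≡⟨ +-assoc (w zero) _ _ ⟩
    w zero + links g            ∎
telescope-link {suc n} g w up dn (suc i) (suc q) = Sum.map step step
    (telescope-link (λ i j → g (suc i) (suc j)) (w ∘ suc) (λ _ _ → up _ _) (λ _ _ → dn _ _) i q)
  where
  step : ∀ {k} → k ≤ w (suc q) + links (λ i j → g (suc i) (suc j)) → k ≤ w (suc q) + links g
  step h = ≤-trans h (+-monoʳ-≤ (w (suc q)) (m≤n+m _ _))

-- The induction peels off row and column `zero`, in each of which only the first two entries can be
-- nonzero.
tridiagonal-sum : ∀ {n} (F : Fin (suc n) → Fin (suc n) → ℕ) →
  (∀ i j → i ≢ j → ¬ Graph.Adj (Path (suc n)) i j → F i j ≡ 0) →
  sum₂ F ≡ sum (λ i → F i i) + (links F + links (λ i j → F j i))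
tridiagonal-sum {zero}  F h = cong (_+ 0) refl
tridiagonal-sum {suc n} F h
  rewrite sum-≡0 {f = λ j → F zero (suc (suc j))} (λ j → h zero (suc (suc j)) (λ ()) (λ { (inj₁ ()) ; (inj₂ ()) }))
        | ∑-distrib-+ (λ i → F (suc i) zero) (λ i → sum (λ j → F (suc i) (suc j)))
        | sum-≡0 {f = λ j → F (suc (suc j)) zero} (λ j → h (suc (suc j)) zero (λ ()) (λ { (inj₁ ()) ; (inj₂ ()) }))
        | tridiagonal-sum (λ i j → F (suc i) (suc j)) (λ i j i≢j ¬adj → h (suc i) (suc j) (i≢j ∘ λ { refl → refl })
            (λ { (inj₁ e) → ¬adj (inj₁ (suc-injective e)) ; (inj₂ e) → ¬adj (inj₂ (suc-injective e)) }))
  = rearrange (F zero zero) (F zero (suc zero)) (F (suc zero) zero) _ _ _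
  where
  rearrange : ∀ a b c d e f → a + (b + 0) + (c + 0 + (d + (e + f))) ≡ a + d + (b + e + (c + f))
  rearrange = solve-∀

sum-∧ : ∀ {n} (r : Fin n → Bool) b → sum (λ y → ⟦ r y ∧ b ⟧) ≡ ⟦ b ⟧ * sum (λ y → ⟦ r y ⟧)
sum-∧ r b = trans (sum-cong-≗ (λ y → ⟦∧⟧ (r y) b))
  (trans (sym (*-distribʳ-sum ⟦ b ⟧ (λ y → ⟦ r y ⟧))) (*-comm (sum (λ y → ⟦ r y ⟧)) ⟦ b ⟧))

sum₂-∧ : ∀ {m n} (X : Fin m → Bool) (Y : Fin n → Bool) → sum₂ (λ x y → ⟦ X x ∧ Y y ⟧) ≡ ∣ X ∣ * ∣ Y ∣
sum₂-∧ X Y = trans (∑-comm (λ x y → ⟦ X x ∧ Y y ⟧))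
  (trans (sum-cong-≗ (λ y → sum-∧ X (Y y)))
    (trans (sym (*-distribʳ-sum ∣ X ∣ (λ y → ⟦ Y y ⟧))) (*-comm ∣ Y ∣ ∣ X ∣)))

does-≟-comm : ∀ {n} (x y : Fin n) → does (x ≟ y) ≡ does (y ≟ x)
does-≟-comm x y = does-⇔ (mk⇔ sym sym) (x ≟ y) (y ≟ x)

-- Arithmetic behind the bounds.

m≤o⊎n≤o⇒m⊓n≤o : ∀ {m n o} → m ≤ o ⊎ n ≤ o → m ⊓ n ≤ o
m≤o⊎n≤o⇒m⊓n≤o {m} {n} = Sum.[ m≤n⇒m⊓o≤n n , m≤n⇒o⊓m≤n m ]

-- Either L ≤ a + b, or L is so large that the quadratic bound takes over.
2L≤c : ∀ a b c L → 1 ≤ a → 1 ≤ b → a + b + L ≤ c → (a + b) * suc L ≤ c + 2 * (a * b) → 2 * L ≤ c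
2L≤c (suc a) (suc b) c L _ _ lin quad with L ≤? suc a + suc b
... | yes L≤a+b = ≤-trans (+-mono-≤ L≤a+b (≤-reflexive (+-identityʳ L))) lin
... | no  L≰a+b with k , refl ← m≤n⇒∃[o]m+o≡n (≰⇒> L≰a+b) =
  -- With A = `suc a`, B = `suc b` and L = A + B + 1 + k, the slack (A + B)(L + 1) - 2AB - 2L equals
  -- A² + B² - 2 + k(A + B - 2).
  +-cancelʳ-≤ (2 * (suc a * suc b)) _ c
    (≤-trans (m≤m+n _ (a * a + 2 * a + b * b + 2 * b + k * (a + b)))
             (≤-trans (≤-reflexive (identity a b k)) quad))
  where
  identity : ∀ a b k → let L = suc (suc a + suc b) + k in
    2 * L + 2 * (suc a * suc b) + (a * a + 2 * a + b * b + 2 * b + k * (a + b)) ≡ (suc a + suc b) * suc L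
  identity = solve-∀

-- Meant for two consecutive independent layers of sizes `a` and `b` with `c` cut links between
-- them: aδ and bδ bound their boundaries, b(δ + 1) the weight of the layer nearer to an empty one.
-- For b ≥ 2 or a ≥ 3 the multiples of δ reach the target; for the sizes 1, 1 and 2, 1 the quadratic
-- bound supplies c ≥ 2δ and c ≥ 3δ - 1.
5δ+1≤ : ∀ a b c δ → 1 ≤ a → 1 ≤ b → 1 ≤ δ → (a + b) * suc δ ≤ c + 2 * (a * b) →
  5 * δ + 1 ≤ a * δ + b * δ + (c + b * suc δ)
5δ+1≤ (suc a) (suc (suc b)) c δ _ _ _ _ =
  ≤-trans (m≤m+n _ (1 + a * δ + b * δ + c + b * suc δ)) (≤-reflexive (identity a b c δ))
  where
  identity : ∀ a b c δ → 5 * δ + 1 + (1 + a * δ + b * δ + c + b * suc δ) ≡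
    suc a * δ + suc (suc b) * δ + (c + suc (suc b) * suc δ)
  identity = solve-∀
5δ+1≤ 1 1 c δ _ _ _ h = begin
  5 * δ + 1                              ≡⟨ left δ ⟩
  2 * δ + (3 * δ + 1)                    ≤⟨ +-monoˡ-≤ (3 * δ + 1) (+-cancelʳ-≤ 2 (2 * δ) c (≤-trans (≤-reflexive (hyp δ)) h)) ⟩
  c + (3 * δ + 1)                        ≡⟨ right c δ ⟩
  1 * δ + 1 * δ + (c + 1 * suc δ)        ∎
  where
  open ≤-Reasoning
  hyp : ∀ δ → 2 * δ + 2 ≡ 2 * suc δ
  hyp = solve-∀
  left : ∀ δ → 5 * δ + 1 ≡ 2 * δ + (3 * δ + 1)
  left = solve-∀
  right : ∀ c δ → c + (3 * δ + 1) ≡ 1 * δ + 1 * δ + (c + 1 * suc δ)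
  right = solve-∀
5δ+1≤ 2 1 c (suc d) _ _ _ h = begin
  5 * suc d + 1                                ≤⟨ m≤m+n _ (2 * d + 1) ⟩
  5 * suc d + 1 + (2 * d + 1)                  ≡⟨ left d ⟩
  3 * d + 2 + (4 * d + 5)                      ≤⟨ +-monoˡ-≤ (4 * d + 5) (+-cancelʳ-≤ 4 (3 * d + 2) c (≤-trans (≤-reflexive (hyp d)) h)) ⟩
  c + (4 * d + 5)                              ≡⟨ right c d ⟩
  2 * suc d + 1 * suc d + (c + 1 * suc (suc d)) ∎
  where
  open ≤-Reasoning
  hyp : ∀ d → 3 * d + 2 + 4 ≡ 3 * suc (suc d)
  hyp = solve-∀
  left : ∀ d → 5 * suc d + 1 + (2 * d + 1) ≡ 3 * d + 2 + (4 * d + 5)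
  left = solve-∀
  right : ∀ c d → c + (4 * d + 5) ≡ 2 * suc d + 1 * suc d + (c + 1 * suc (suc d))
  right = solve-∀
5δ+1≤ (suc (suc (suc a))) 1 c δ _ _ _ _ =
  ≤-trans (m≤m+n _ (a * δ + c)) (≤-reflexive (identity a c δ))
  where
  identity : ∀ a c δ → 5 * δ + 1 + (a * δ + c) ≡ suc (suc (suc a)) * δ + 1 * δ + (c + 1 * suc δ)
  identity = solve-∀

-- Cuts of the strong product of a graph on Fin m, given by its adjacency matrix a, with a path;
-- a vertex set is the family of its layers.
module Layers {m : ℕ} (a : Fin m → Fin m → Bool)
              (a-sym : ∀ x y → a x y ≡ a y x) (a-irrefl : ∀ x → a x x ≡ false) where

  -- Boundary, links and weight of layers.

  -- Closed neighbourhoods: these are exactly the pairs that are joined between two consecutive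
  -- layers of the product.
  N : Fin m → Fin m → Bool
  N x y = does (x ≟ y) ∨ a x y

  deg : Fin m → ℕ
  deg x = sum (λ y → ⟦ a x y ⟧)

  ∂ : (Fin m → Bool) → ℕ
  ∂ X = sum₂ (λ x y → ⟦ a x y ∧ (X x ∧ not (X y)) ⟧)

  c : (Fin m → Bool) → (Fin m → Bool) → ℕ
  c X Y = sum₂ (λ x y → ⟦ N x y ∧ (X x xor Y y) ⟧)

  -- Written over pairs so that it can be compared with `c` term by term; `w≡` recovers the sum of
  -- deg + 1 over `X`.
  w : (Fin m → Bool) → ℕ
  w X = sum₂ (λ x y → ⟦ N x y ∧ X x ⟧)

  -- The number of edges between two consecutive layers, which is m + 2e.
  W : ℕ
  W = sum₂ (λ x y → ⟦ N x y ⟧)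

  cut : ∀ {n} → (Fin (suc n) → Fin m → Bool) → ℕ
  cut A = sum (λ i → ∂ (A i)) + links (λ i j → c (A i) (A j))

  a⇒≢ : ∀ {x y} → a x y ≡ true → x ≢ y
  a⇒≢ {x} axy refl with () ← trans (sym axy) (a-irrefl x)

  N-sym : ∀ x y → N x y ≡ N y x
  N-sym x y = cong₂ _∨_ (does-≟-comm x y) (a-sym x y)

  N-split : ∀ x y b → ⟦ N x y ∧ b ⟧ ≡ ⟦ does (x ≟ y) ∧ b ⟧ + ⟦ a x y ∧ b ⟧
  N-split x y b with x ≟ y
  ... | yes refl rewrite a-irrefl x = sym (+-identityʳ _)
  ... | no  _    = refl

  sum₂-N : ∀ (f : Fin m → Fin m → Bool) →
    sum₂ (λ x y → ⟦ N x y ∧ f x y ⟧) ≡ sum (λ x → ⟦ f x x ⟧) + sum₂ (λ x y → ⟦ a x y ∧ f x y ⟧)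
  sum₂-N f = trans (sum₂-cong (λ x y → N-split x y (f x y)))
    (trans (sum₂-+ (λ x y → ⟦ does (x ≟ y) ∧ f x y ⟧) (λ x y → ⟦ a x y ∧ f x y ⟧))
      (cong (_+ sum₂ (λ x y → ⟦ a x y ∧ f x y ⟧)) (sum-cong-≗ (λ x → sum-δ x (f x)))))

  W≡m+∑deg : W ≡ m + sum deg
  W≡m+∑deg = trans (sum₂-cong (λ x y → cong ⟦_⟧ (sym (∧-identityʳ (N x y)))))
    (trans (sum₂-N (λ _ _ → true))
      (cong₂ _+_ (trans (sum-const m 1) (*-identityʳ m)) (sum₂-cong (λ x y → cong ⟦_⟧ (∧-identityʳ (a x y))))))

  sum-N : ∀ x → sum (λ y → ⟦ N x y ⟧) ≡ suc (deg x)
  sum-N x = trans (sum-cong-≗ (λ y → trans (cong ⟦_⟧ (sym (∧-identityʳ (N x y)))) (N-split x y true)))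
    (trans (∑-distrib-+ (λ y → ⟦ does (x ≟ y) ∧ true ⟧) (λ y → ⟦ a x y ∧ true ⟧))
      (cong₂ _+_ (sum-δ x (λ _ → true)) (sum-cong-≗ (λ y → cong ⟦_⟧ (∧-identityʳ (a x y))))))

  w≡ : ∀ X → w X ≡ sum (λ x → ⟦ X x ⟧ * suc (deg x))
  w≡ X = sum-cong-≗ (λ x → trans (sum-∧ (N x) (X x)) (cong (⟦ X x ⟧ *_) (sum-N x)))

  w-transpose : ∀ X → w X ≡ sum₂ (λ x y → ⟦ N x y ∧ X y ⟧)
  w-transpose X = trans (∑-comm (λ x y → ⟦ N x y ∧ X x ⟧))
    (sum₂-cong (λ x y → cong (λ b → ⟦ b ∧ X y ⟧) (N-sym y x)))

  c-comm : ∀ X Y → c X Y ≡ c Y X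
  c-comm X Y = trans (∑-comm (λ x y → ⟦ N x y ∧ (X x xor Y y) ⟧))
    (sum₂-cong (λ x y → cong₂ (λ p q → ⟦ p ∧ q ⟧) (N-sym y x) (xor-comm (X y) (Y x))))

  -- Inequalities between links, weights and boundaries.

  -- A linked pair that starts in `X` either ends in `Y` or is counted by `c`; by symmetry of `N`,
  -- `w Y` counts the pairs that end in `Y`.
  w≤w+c : ∀ X Y → w X ≤ w Y + c X Y
  w≤w+c X Y = begin
    w X                                                                    ≤⟨ sum₂-mono (λ x y → pointwise (N x y) (X x) (Y y)) ⟩
    sum₂ (λ x y → ⟦ N x y ∧ Y y ⟧ + ⟦ N x y ∧ (X x xor Y y) ⟧)             ≡⟨ sum₂-+ (λ x y → ⟦ N x y ∧ Y y ⟧) (λ x y → ⟦ N x y ∧ (X x xor Y y) ⟧) ⟩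
    sum₂ (λ x y → ⟦ N x y ∧ Y y ⟧) + c X Y                                 ≡⟨ cong (_+ c X Y) (w-transpose Y) ⟨
    w Y + c X Y                                                            ∎
    where
    open ≤-Reasoning
    pointwise : ∀ n p q → ⟦ n ∧ p ⟧ ≤ ⟦ n ∧ q ⟧ + ⟦ n ∧ (p xor q) ⟧
    pointwise = toWitness {a? = ∀Bool? λ n → ∀Bool? λ p → ∀Bool? λ q → _ ≤? _} _

  w≤w+c′ : ∀ X Y → w X ≤ w Y + c Y X
  w≤w+c′ X Y = subst (λ k → w X ≤ w Y + k) (c-comm X Y) (w≤w+c X Y)

  w-empty : ∀ X → (∀ x → X x ≡ false) → w X ≡ 0
  w-empty X X≡∅ = sum-≡0 (λ x → sum-≡0 (λ y → cong ⟦_⟧ (trans (cong (N x y ∧_) (X≡∅ x)) (∧-zeroʳ (N x y)))))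

  _∩_ _∪_ : (Fin m → Bool) → (Fin m → Bool) → (Fin m → Bool)
  (X ∩ Y) x = X x ∧ Y x
  (X ∪ Y) x = X x ∨ Y x

  ∁ : (Fin m → Bool) → (Fin m → Bool)
  ∁ X x = not (X x)

  ∂-∁ : ∀ X → ∂ (∁ X) ≤ ∂ X
  ∂-∁ X = sum₂-mono-sym pointwise′
    where
    pointwise : ∀ e p q → ⟦ e ∧ (not p ∧ not (not q)) ⟧ + ⟦ e ∧ (not q ∧ not (not p)) ⟧ ≤
                          ⟦ e ∧ (p ∧ not q) ⟧ + ⟦ e ∧ (q ∧ not p) ⟧
    pointwise = toWitness {a? = ∀Bool? λ e → ∀Bool? λ p → ∀Bool? λ q → _ ≤? _} _
    pointwise′ : ∀ x y → ⟦ a x y ∧ (not (X x) ∧ not (not (X y))) ⟧ + ⟦ a y x ∧ (not (X y) ∧ not (not (X x))) ⟧ ≤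
                         ⟦ a x y ∧ (X x ∧ not (X y)) ⟧ + ⟦ a y x ∧ (X y ∧ not (X x)) ⟧
    pointwise′ x y rewrite a-sym y x = pointwise (a x y) (X x) (X y)

  c-∁ : ∀ X Y → c (∁ X) (∁ Y) ≡ c X Y
  c-∁ X Y = sum₂-cong (λ x y → cong (λ b → ⟦ N x y ∧ b ⟧) (not-xor-not (X x) (Y y)))
    where
    not-xor-not : ∀ p q → not p xor not q ≡ p xor q
    not-xor-not = toWitness {a? = ∀Bool? λ p → ∀Bool? λ q → _ Bool.≟ _} _

  cut-∁ : ∀ {n} (A : Fin (suc n) → Fin m → Bool) → cut (∁ ∘ A) ≤ cut A
  cut-∁ A = +-mono-≤ (sum-mono (λ i → ∂-∁ (A i))) (≤-reflexive (sum-cong-≗ (λ i → c-∁ (A (inject₁ i)) (A (suc i)))))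

  -- An uncrossing argument. The diagonal of `N` contributes the symmetric difference exactly; the
  -- remaining pairs are edges of the graph, each settled by a truth table in the memberships of its
  -- two ends.
  symmetric-difference+∂∩+∂∪≤c : ∀ X Y → sum (λ x → ⟦ X x xor Y x ⟧) + (∂ (X ∩ Y) + ∂ (X ∪ Y)) ≤ c X Y
  symmetric-difference+∂∩+∂∪≤c X Y =
    subst (sum (λ x → ⟦ X x xor Y x ⟧) + (∂ (X ∩ Y) + ∂ (X ∪ Y)) ≤_) (sym (sum₂-N (λ x y → X x xor Y y)))
      (+-monoʳ-≤ (sum (λ x → ⟦ X x xor Y x ⟧)) (begin
        ∂ (X ∩ Y) + ∂ (X ∪ Y)                    ≡⟨ sum₂-+ (λ x y → ⟦ a x y ∧ ((X ∩ Y) x ∧ not ((X ∩ Y) y)) ⟧) (λ x y → ⟦ a x y ∧ ((X ∪ Y) x ∧ not ((X ∪ Y) y)) ⟧) ⟨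
        -- Symmetrising is essential: an edge from `X ∩ Y` to the outside of `X ∪ Y` counts twice on
        -- the left in one orientation, but once on the right in each.
        sum₂ f                                   ≤⟨ sum₂-mono-sym pointwise′ ⟩
        sum₂ (λ x y → ⟦ a x y ∧ (X x xor Y y) ⟧) ∎))
    where
    open ≤-Reasoning
    f : Fin m → Fin m → ℕ
    f x y = ⟦ a x y ∧ ((X ∩ Y) x ∧ not ((X ∩ Y) y)) ⟧ + ⟦ a x y ∧ ((X ∪ Y) x ∧ not ((X ∪ Y) y)) ⟧
    pointwise : ∀ e p q r s →
      ⟦ e ∧ ((p ∧ q) ∧ not (r ∧ s)) ⟧ + ⟦ e ∧ ((p ∨ q) ∧ not (r ∨ s)) ⟧ +
      (⟦ e ∧ ((r ∧ s) ∧ not (p ∧ q)) ⟧ + ⟦ e ∧ ((r ∨ s) ∧ not (p ∨ q)) ⟧) ≤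
      ⟦ e ∧ (p xor s) ⟧ + ⟦ e ∧ (r xor q) ⟧
    pointwise = toWitness {a? = ∀Bool? λ e → ∀Bool? λ p → ∀Bool? λ q → ∀Bool? λ r → ∀Bool? λ s → _ ≤? _} _
    pointwise′ : ∀ x y → f x y + f y x ≤ ⟦ a x y ∧ (X x xor Y y) ⟧ + ⟦ a y x ∧ (X y xor Y x) ⟧
    pointwise′ x y rewrite a-sym y x = pointwise (a x y) (X x) (Y x) (X y) (Y y)

  -- A linked pair with just one of x ∈ `X`, y ∈ `Y` is counted by `c`. A pair with both counts
  -- twice on the left, and there are at most |X||Y| of these.
  w+w≤c+2∣∣∣∣ : ∀ X Y → w X + w Y ≤ c X Y + 2 * (∣ X ∣ * ∣ Y ∣)
  w+w≤c+2∣∣∣∣ X Y = begin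
    w X + w Y                                                            ≡⟨ cong (w X +_) (w-transpose Y) ⟩
    w X + sum₂ (λ x y → ⟦ N x y ∧ Y y ⟧)                                 ≡⟨ sum₂-+ (λ x y → ⟦ N x y ∧ X x ⟧) (λ x y → ⟦ N x y ∧ Y y ⟧) ⟨
    sum₂ (λ x y → ⟦ N x y ∧ X x ⟧ + ⟦ N x y ∧ Y y ⟧)                     ≤⟨ sum₂-mono (λ x y → pointwise (N x y) (X x) (Y y)) ⟩
    sum₂ (λ x y → ⟦ N x y ∧ (X x xor Y y) ⟧ + (z x y + z x y))           ≡⟨ sum₂-+ (λ x y → ⟦ N x y ∧ (X x xor Y y) ⟧) (λ x y → z x y + z x y) ⟩
    c X Y + sum₂ (λ x y → z x y + z x y)                                 ≡⟨ cong (c X Y +_) (sum₂-+ z z) ⟩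
    c X Y + (sum₂ z + sum₂ z)                                            ≡⟨ cong (λ k → c X Y + (k + k)) (sum₂-∧ X Y) ⟩
    c X Y + (∣ X ∣ * ∣ Y ∣ + ∣ X ∣ * ∣ Y ∣)                              ≡⟨ cong (λ k → c X Y + (∣ X ∣ * ∣ Y ∣ + k)) (+-identityʳ _) ⟨
    c X Y + 2 * (∣ X ∣ * ∣ Y ∣)                                          ∎
    where
    open ≤-Reasoning
    z : Fin m → Fin m → ℕ
    z x y = ⟦ X x ∧ Y y ⟧
    pointwise : ∀ n p q → ⟦ n ∧ p ⟧ + ⟦ n ∧ q ⟧ ≤ ⟦ n ∧ (p xor q) ⟧ + (⟦ p ∧ q ⟧ + ⟦ p ∧ q ⟧)
    pointwise = toWitness {a? = ∀Bool? λ n → ∀Bool? λ p → ∀Bool? λ q → _ ≤? _} _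

  -- Every linked pair is cut somewhere: a vertical one, or one with both ends on the same side of
  -- `X`, is cut between the layers, and one that crosses `X` is cut within a layer, by `∂ X` or
  -- `∂ Y` according to its direction.
  W≤complementary : ∀ X Y → (∀ x → Y x ≡ not (X x)) → W ≤ ∂ X + ∂ Y + c X Y
  W≤complementary X Y Y≡∁X = begin
    W                                                        ≤⟨ sum₂-mono (λ x y → pointwise′ x y) ⟩
    sum₂ (λ x y → f x y + g x y + h x y)                     ≡⟨ sum₂-+ (λ x y → f x y + g x y) h ⟩
    sum₂ (λ x y → f x y + g x y) + c X Y                     ≡⟨ cong (_+ c X Y) (sum₂-+ f g) ⟩
    ∂ X + ∂ Y + c X Y                                        ∎
    where
    open ≤-Reasoning
    f g h : Fin m → Fin m → ℕ
    f x y = ⟦ a x y ∧ (X x ∧ not (X y)) ⟧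
    g x y = ⟦ a x y ∧ (Y x ∧ not (Y y)) ⟧
    h x y = ⟦ N x y ∧ (X x xor Y y) ⟧
    diagonal : ∀ p e → 1 ≤ e + ⟦ p xor not p ⟧
    diagonal true  e = m≤n+m 1 e
    diagonal false e = m≤n+m 1 e
    pointwise : ∀ e p q → ⟦ e ⟧ ≤ ⟦ e ∧ (p ∧ not q) ⟧ + ⟦ e ∧ (not p ∧ not (not q)) ⟧ + ⟦ e ∧ (p xor not q) ⟧
    pointwise = toWitness {a? = ∀Bool? λ e → ∀Bool? λ p → ∀Bool? λ q → _ ≤? _} _
    pointwise′ : ∀ x y → ⟦ N x y ⟧ ≤ f x y + g x y + h x y
    pointwise′ x y with x ≟ y
    ... | yes refl rewrite Y≡∁X x = diagonal (X x) _
    ... | no  _    rewrite Y≡∁X x | Y≡∁X y = pointwise (a x y) (X x) (X y)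

  -- One copy of the two degrees comes from the weights of `x` and `y` themselves. In the other
  -- copy, neighbours outside `X` are boundary edges and neighbours inside `X` are paid for by
  -- weight.
  edge⇒2degrees≤w+∂ : ∀ X {x y} → a x y ≡ true → X x ≡ true → X y ≡ true →
    2 * (deg x + deg y) ≤ w X + ∂ X
  edge⇒2degrees≤w+∂ X {x} {y} axy Xx Xy = begin
    2 * (deg x + deg y)                                                        ≡⟨ cong (λ k → deg x + deg y + k) (+-identityʳ _) ⟩
    deg x + deg y + (deg x + deg y)                                            ≡⟨ cong (deg x + deg y +_) (cong₂ _+_ (split x) (split y)) ⟩
    deg x + deg y + (inner x + outer x + (inner y + outer y))                  ≡⟨ rearrange (deg x) (deg y) (inner x) (outer x) (inner y) (outer y) ⟩
    deg x + deg y + (inner x + inner y) + (outer x + outer y)                  ≤⟨ +-mono-≤ inside outside ⟩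
    w X + ∂ X                                                                  ∎
    where
    open ≤-Reasoning
    rearrange : ∀ a b c d e f → a + b + (c + d + (e + f)) ≡ a + b + (c + e) + (d + f)
    rearrange = solve-∀
    inner outer : Fin m → ℕ
    inner u = sum (λ v → ⟦ a u v ∧ X v ⟧)
    outer u = sum (λ v → ⟦ a u v ∧ not (X v) ⟧)
    split : ∀ u → deg u ≡ inner u + outer u
    split u = trans (sum-cong-≗ (λ v → excluded-middle (a u v) (X v)))
                    (∑-distrib-+ (λ v → ⟦ a u v ∧ X v ⟧) (λ v → ⟦ a u v ∧ not (X v) ⟧))
      where
      excluded-middle : ∀ e p → ⟦ e ⟧ ≡ ⟦ e ∧ p ⟧ + ⟦ e ∧ not p ⟧
      excluded-middle = toWitness {a? = ∀Bool? λ e → ∀Bool? λ p → _ ℕ.≟ _} _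
    x≢y : x ≢ y
    x≢y = a⇒≢ axy
    outside : outer x + outer y ≤ ∂ X
    outside = subst (_≤ ∂ X) (cong₂ _+_ (row Xx) (row Xy))
        (two-terms≤sum (λ u → sum (λ v → ⟦ a u v ∧ (X u ∧ not (X v)) ⟧)) x≢y)
      where
      row : ∀ {u} → X u ≡ true → sum (λ v → ⟦ a u v ∧ (X u ∧ not (X v)) ⟧) ≡ outer u
      row {u} Xu = sum-cong-≗ (λ v → cong (λ b → ⟦ a u v ∧ (b ∧ not (X v)) ⟧) Xu)
    point : Fin m → ℕ → Fin m → ℕ
    point u k v = ⟦ does (u ≟ v) ⟧ * k
    -- A vertex u of X other than x and y contributes deg u + 1 ≥ 2 to w, which pays for the edges ux and uy.
    pointwise : ∀ u → point x (deg x) u + point y (deg y) u + (⟦ a x u ∧ X u ⟧ + ⟦ a y u ∧ X u ⟧) ≤ ⟦ X u ⟧ * suc (deg u)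
    pointwise u with x ≟ u | y ≟ u
    ... | yes refl | yes refl = contradiction refl x≢y
    ... | yes refl | no _ rewrite Xx | a-irrefl x | trans (a-sym y x) axy = ≤-reflexive (eq (deg x))
      where
      eq : ∀ k → 1 * k + 0 + 1 ≡ 1 * suc k
      eq = solve-∀
    ... | no _ | yes refl rewrite Xy | a-irrefl y | axy = ≤-reflexive (eq (deg y))
      where
      eq : ∀ k → 1 * k + 1 ≡ 1 * suc k
      eq = solve-∀
    ... | no _ | no _ with X u
    ...   | false rewrite ∧-zeroʳ (a x u) | ∧-zeroʳ (a y u) = z≤n
    ...   | true  rewrite ∧-identityʳ (a x u) | ∧-identityʳ (a y u) with a x u in axu | a y u in ayu
    ...     | false | false = z≤n
    ...     | true  | false = s≤s z≤n
    ...     | false | true  = s≤s z≤n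
    ...     | true  | true  = s≤s (≤-trans (subst (λ b → ⟦ b ⟧ ≤ deg u) (trans (a-sym u x) axu) (term≤sum _ x)) (m≤m+n _ 0))
    inside : deg x + deg y + (inner x + inner y) ≤ w X
    inside = begin
      deg x + deg y + (inner x + inner y)
        ≡⟨ cong₂ (λ j k → j + k + (inner x + inner y)) (sum-δ-* x (λ _ → deg x)) (sum-δ-* y (λ _ → deg y)) ⟨
      sum (point x (deg x)) + sum (point y (deg y)) + (inner x + inner y)
        ≡⟨ cong₂ _+_ (∑-distrib-+ (point x (deg x)) (point y (deg y))) (∑-distrib-+ (λ u → ⟦ a x u ∧ X u ⟧) (λ u → ⟦ a y u ∧ X u ⟧)) ⟨
      sum (λ u → point x (deg x) u + point y (deg y) u) + sum (λ u → ⟦ a x u ∧ X u ⟧ + ⟦ a y u ∧ X u ⟧)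
        ≡⟨ ∑-distrib-+ (λ u → point x (deg x) u + point y (deg y) u) (λ u → ⟦ a x u ∧ X u ⟧ + ⟦ a y u ∧ X u ⟧) ⟨
      sum (λ u → point x (deg x) u + point y (deg y) u + (⟦ a x u ∧ X u ⟧ + ⟦ a y u ∧ X u ⟧))
        ≤⟨ sum-mono pointwise ⟩
      sum (λ u → ⟦ X u ⟧ * suc (deg u))
        ≡⟨ w≡ X ⟨
      w X ∎

  independent⇒∑deg≤∂ : ∀ X → (∀ x y → X x ≡ true → X y ≡ true → a x y ≡ true → ⊥) →
    sum (λ x → ⟦ X x ⟧ * deg x) ≤ ∂ X
  independent⇒∑deg≤∂ X indep = ≤-trans (≤-reflexive (sum-cong-≗ (λ x → sym (sum-∧ (a x) (X x))))) (sum₂-mono pointwise)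
    where
    pointwise : ∀ x y → ⟦ a x y ∧ X x ⟧ ≤ ⟦ a x y ∧ (X x ∧ not (X y)) ⟧
    pointwise x y with a x y in axy | X x in Xx | X y in Xy
    ... | true  | true  | true  = ⊥-elim (indep x y Xx Xy axy)
    ... | true  | true  | false = ≤-refl
    ... | true  | false | _     = z≤n
    ... | false | _     | _     = z≤n

  -- The lower bound for cuts of layered sets.

  Nonempty : (Fin m → Bool) → Set
  Nonempty X = ∃ λ x → X x ≡ true

  nonempty? : ∀ X → Dec (Nonempty X)
  nonempty? X = Fin.any? (λ x → X x Bool.≟ true)

  ¬nonempty⇒empty : ∀ {X} → ¬ Nonempty X → ∀ x → X x ≡ false
  ¬nonempty⇒empty {X} ¬ne x with X x in Xx
  ... | true  = contradiction (x , Xx) ¬ne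
  ... | false = refl

  ∣∣*≤sum : ∀ X {k} {f : Fin m → ℕ} → (∀ x → k ≤ f x) → ∣ X ∣ * k ≤ sum (λ x → ⟦ X x ⟧ * f x)
  ∣∣*≤sum X {k} k≤f = ≤-trans (≤-reflexive (*-distribʳ-sum k (λ x → ⟦ X x ⟧)))
    (sum-mono (λ x → *-monoʳ-≤ ⟦ X x ⟧ (k≤f x)))

  ∣∣*suc≤w : ∀ X {k} → (∀ x → k ≤ deg x) → ∣ X ∣ * suc k ≤ w X
  ∣∣*suc≤w X k≤deg = ≤-trans (∣∣*≤sum X (λ x → s≤s (k≤deg x))) (≤-reflexive (sym (w≡ X)))

  [∣∣+∣∣]*suc≤ : ∀ X Y {k} → (∀ x → k ≤ deg x) → (∣ X ∣ + ∣ Y ∣) * suc k ≤ c X Y + 2 * (∣ X ∣ * ∣ Y ∣)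
  [∣∣+∣∣]*suc≤ X Y {k} k≤deg = begin
    (∣ X ∣ + ∣ Y ∣) * suc k             ≡⟨ *-distribʳ-+ (suc k) ∣ X ∣ ∣ Y ∣ ⟩
    ∣ X ∣ * suc k + ∣ Y ∣ * suc k       ≤⟨ +-mono-≤ (∣∣*suc≤w X k≤deg) (∣∣*suc≤w Y k≤deg) ⟩
    w X + w Y                           ≤⟨ w+w≤c+2∣∣∣∣ X Y ⟩
    c X Y + 2 * (∣ X ∣ * ∣ Y ∣)         ∎
    where open ≤-Reasoning

  -- A weakened form of an edge inside the set: `between` forgets which vertices are joined and
  -- keeps only that two consecutive layers are nonempty.
  data Edge {n : ℕ} (A : Fin (suc n) → Fin m → Bool) : Set where
    within  : ∀ i {x y} → a x y ≡ true → A i x ≡ true → A i y ≡ true → Edge A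
    between : ∀ i → Nonempty (A (inject₁ i)) → Nonempty (A (suc i)) → Edge A

  module LowerBound (L ξ δ : ℕ) (1≤δ : 1 ≤ δ) (L≤δ : L ≤ δ) (δ≤deg : ∀ x → δ ≤ deg x)
                    (ξ+2≤deg+deg : ∀ {x y} → a x y ≡ true → ξ + 2 ≤ deg x + deg y)
                    (L≤∂ : ∀ X → Nonempty X → Nonempty (∁ X) → L ≤ ∂ X) where

    -- By disjointness the symmetric difference has |X| + |Y| elements, and `∂ (X ∪ Y)` is at least
    -- `L`: this is the linear hypothesis of `2L≤c`. The quadratic one holds because all degrees are
    -- at least `L`.
    disjoint⇒2L≤c : ∀ X Y → Nonempty X → Nonempty Y → (∀ x → X x ∧ Y x ≡ false) → Nonempty (∁ (X ∪ Y)) →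
      2 * L ≤ c X Y
    disjoint⇒2L≤c X Y neX@(x , Xx) neY disjoint ne∁ =
      2L≤c ∣ X ∣ ∣ Y ∣ (c X Y) L (nonempty⇒1≤∣∣ neX) (nonempty⇒1≤∣∣ neY)
        (begin
          ∣ X ∣ + ∣ Y ∣ + L                                                   ≡⟨ cong (_+ L) (∑-distrib-+ (λ x → ⟦ X x ⟧) (λ x → ⟦ Y x ⟧)) ⟨
          sum (λ x → ⟦ X x ⟧ + ⟦ Y x ⟧) + L                                   ≤⟨ +-mono-≤ (sum-mono (λ x → pointwise (X x) (Y x) (disjoint x)))
                                                                                          (≤-trans (L≤∂ (X ∪ Y) (x , cong (_∨ Y x) Xx) ne∁) (m≤n+m _ (∂ (X ∩ Y)))) ⟩
          sum (λ x → ⟦ X x xor Y x ⟧) + (∂ (X ∩ Y) + ∂ (X ∪ Y))               ≤⟨ symmetric-difference+∂∩+∂∪≤c X Y ⟩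
          c X Y                                                               ∎)
        ([∣∣+∣∣]*suc≤ X Y (λ x → ≤-trans L≤δ (δ≤deg x)))
      where
      open ≤-Reasoning
      pointwise : ∀ p q → p ∧ q ≡ false → ⟦ p ⟧ + ⟦ q ⟧ ≤ ⟦ p xor q ⟧
      pointwise true  false _ = ≤-refl
      pointwise false q     _ = ≤-refl

    -- If `X ∩ Y` is nonempty and `X ∪ Y` is not everything, both have boundary at least `L`. If
    -- only one of these fails, either `X` and `Y` or their complements are disjoint without
    -- covering everything; if both fail, the layers are complementary.
    2L≤c⊎W≤ : ∀ X Y → Nonempty X → Nonempty Y → Nonempty (∁ X) → Nonempty (∁ Y) →
      2 * L ≤ c X Y ⊎ W ≤ ∂ X + ∂ Y + c X Y
    2L≤c⊎W≤ X Y neX@(x , Xx) neY ne∁X@(x′ , ∁Xx′) ne∁Y with nonempty? (X ∩ Y) | nonempty? (∁ (X ∪ Y))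
    ... | yes ne∩ | yes ne∁∪ = inj₁ (begin
      2 * L                                                               ≡⟨ cong (L +_) (+-identityʳ L) ⟩
      L + L                                                               ≤⟨ +-mono-≤ (L≤∂ (X ∩ Y) ne∩ (x′ , not-∧ (X x′) (Y x′) ∁Xx′)) (L≤∂ (X ∪ Y) (x , cong (_∨ Y x) Xx) ne∁∪) ⟩
      ∂ (X ∩ Y) + ∂ (X ∪ Y)                                               ≤⟨ m≤n+m _ (sum (λ x → ⟦ X x xor Y x ⟧)) ⟩
      sum (λ x → ⟦ X x xor Y x ⟧) + (∂ (X ∩ Y) + ∂ (X ∪ Y))               ≤⟨ symmetric-difference+∂∩+∂∪≤c X Y ⟩
      c X Y                                                               ∎)
      where
      open ≤-Reasoning
      not-∧ : ∀ p q → not p ≡ true → not (p ∧ q) ≡ true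
      not-∧ false q _ = refl
    ... | no ¬ne∩ | yes ne∁∪ = inj₁ (disjoint⇒2L≤c X Y neX neY (¬nonempty⇒empty {X ∩ Y} ¬ne∩) ne∁∪)
    ... | yes (z , Xz∧Yz) | no ¬ne∁∪ = inj₁ (subst (2 * L ≤_) (c-∁ X Y)
        (disjoint⇒2L≤c (∁ X) (∁ Y) ne∁X ne∁Y
          (λ x → trans (sym (not-∨ (X x) (Y x))) (¬nonempty⇒empty {∁ (X ∪ Y)} ¬ne∁∪ x))
          (z , trans (not-not-∧ (X z) (Y z)) Xz∧Yz)))
      where
      not-∨ : ∀ p q → not (p ∨ q) ≡ not p ∧ not q
      not-∨ = toWitness {a? = ∀Bool? λ p → ∀Bool? λ q → _ Bool.≟ _} _
      not-not-∧ : ∀ p q → not (not p ∨ not q) ≡ p ∧ q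
      not-not-∧ = toWitness {a? = ∀Bool? λ p → ∀Bool? λ q → _ Bool.≟ _} _
    ... | no ¬ne∩ | no ¬ne∁∪ = inj₂ (W≤complementary X Y
        (λ x → complementary (X x) (Y x) (¬nonempty⇒empty {X ∩ Y} ¬ne∩ x) (¬nonempty⇒empty {∁ (X ∪ Y)} ¬ne∁∪ x)))
      where
      complementary : ∀ p q → p ∧ q ≡ false → not (p ∨ q) ≡ false → q ≡ not p
      complementary true  false _ _ = refl
      complementary false true  _ _ = refl

    -- The n + 1 layers contribute at least L each and the n links 2L each, in total (3n + 1)L. If
    -- some link falls short of 2L, its two layers are complementary, and their boundaries together
    -- with this link already reach `W`.
    all-layers-proper : ∀ {n} (A : Fin (suc n) → Fin m → Bool) →
      (∀ i → Nonempty (A i)) → (∀ i → Nonempty (∁ (A i))) →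
      (3 * suc n ∸ 2) * L ≤ cut A ⊎ W ≤ cut A
    all-layers-proper {n} A ne ne∁ with Fin.all? (λ i → 2 * L ≤? c (A (inject₁ i)) (A (suc i)))
    ... | yes 2L≤c = inj₁ (begin
      (3 * suc n ∸ 2) * L                                 ≡⟨ cong (λ k → (k ∸ 2) * L) (*-suc 3 n) ⟩
      (1 + 3 * n) * L                                     ≡⟨ rearrange n L ⟩
      suc n * L + n * (2 * L)                             ≡⟨ cong₂ _+_ (sum-const (suc n) L) (sum-const n (2 * L)) ⟨
      sum {suc n} (λ _ → L) + sum {n} (λ _ → 2 * L)       ≤⟨ +-mono-≤ (sum-mono (λ i → L≤∂ (A i) (ne i) (ne∁ i))) (sum-mono 2L≤c) ⟩
      cut A                                               ∎)
      where
      open ≤-Reasoning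
      rearrange : ∀ n L → (1 + 3 * n) * L ≡ suc n * L + n * (2 * L)
      rearrange = solve-∀
    ... | no ¬2L≤c with i , ¬2L≤cᵢ ← Fin.¬∀⟶∃¬ n _ (λ i → 2 * L ≤? c (A (inject₁ i)) (A (suc i))) ¬2L≤c
                   with 2L≤c⊎W≤ (A (inject₁ i)) (A (suc i)) (ne _) (ne _) (ne∁ _) (ne∁ _)
    ...   | inj₁ 2L≤cᵢ = contradiction 2L≤cᵢ ¬2L≤cᵢ
    ...   | inj₂ W≤    = inj₂ (≤-trans W≤
              (+-mono-≤ (two-terms≤sum (∂ ∘ A) (inject₁≢suc i)) (term≤sum (λ i → c (A (inject₁ i)) (A (suc i))) i)))

    -- The weight of the empty layer `q` is zero, so telescoping from a layer towards `q` bounds the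
    -- weight of that layer by the links alone and leaves the boundaries free for the rest of the
    -- estimate.
    some-layer-empty : ∀ {n} (A : Fin (suc n) → Fin m → Bool) q → (∀ x → A q x ≡ false) → Edge A →
      2 * ξ + 4 ≤ cut A ⊎ 5 * δ + 1 ≤ cut A
    some-layer-empty {n} A q A[q]≡∅ = go
      where
      open ≤-Reasoning
      g : Fin (suc n) → Fin (suc n) → ℕ
      g i j = c (A i) (A j)
      w-up : ∀ i j → w (A i) ≤ w (A j) + g i j
      w-up i j = w≤w+c (A i) (A j)
      w-down : ∀ i j → w (A i) ≤ w (A j) + g j i
      w-down i j = w≤w+c′ (A i) (A j)
      drop-q : ∀ {k} → k ≤ w (A q) + links g → k ≤ links g
      drop-q {k} = subst (λ z → k ≤ z + links g) (w-empty (A q) A[q]≡∅)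
      edge : ∀ i {x y} → a x y ≡ true → A i x ≡ true → A i y ≡ true → 2 * ξ + 4 ≤ cut A
      edge i {x} {y} axy Ax Ay = begin
        2 * ξ + 4              ≡⟨ *-distribˡ-+ 2 ξ 2 ⟨
        2 * (ξ + 2)            ≤⟨ *-monoʳ-≤ 2 (ξ+2≤deg+deg axy) ⟩
        2 * (deg x + deg y)    ≤⟨ edge⇒2degrees≤w+∂ (A i) axy Ax Ay ⟩
        w (A i) + ∂ (A i)      ≡⟨ +-comm (w (A i)) _ ⟩
        ∂ (A i) + w (A i)      ≤⟨ +-mono-≤ (term≤sum (∂ ∘ A) i) (drop-q (telescope g (w ∘ A) w-up w-down i q)) ⟩
        cut A                  ∎
      edge? : ∀ i → Dec (∃ λ x → ∃ λ y → A i x ≡ true × A i y ≡ true × a x y ≡ true)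
      edge? i = Fin.any? λ x → Fin.any? λ y → (A i x Bool.≟ true) ×-dec (A i y Bool.≟ true) ×-dec (a x y Bool.≟ true)
      independent⇒ : ∀ i → ¬ (∃ λ x → ∃ λ y → A i x ≡ true × A i y ≡ true × a x y ≡ true) → ∣ A i ∣ * δ ≤ ∂ (A i)
      independent⇒ i ¬edge = ≤-trans (∣∣*≤sum (A i) δ≤deg)
        (independent⇒∑deg≤∂ (A i) (λ x y Ax Ay axy → ¬edge (x , y , Ax , Ay , axy)))
      go : Edge A → 2 * ξ + 4 ≤ cut A ⊎ 5 * δ + 1 ≤ cut A
      go (within i axy Ax Ay) = inj₁ (edge i axy Ax Ay)
      go (between i neX neY) with edge? (inject₁ i) | edge? (suc i)
      ... | yes (x , y , Ax , Ay , axy) | _ = inj₁ (edge (inject₁ i) axy Ax Ay)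
      ... | no _ | yes (x , y , Ax , Ay , axy) = inj₁ (edge (suc i) axy Ax Ay)
      -- Every edge at a vertex of an independent layer leaves that layer, so both boundaries are
      -- large. The walk to `q` starts at the end of the link nearer to `q`, hence the link itself
      -- is still available; the two cases differ by exchanging `X` and `Y`.
      ... | no indepX | no indepY with telescope-link g (w ∘ A) w-up w-down i q
      ...   | inj₂ viaY = inj₂ (begin
        5 * δ + 1
          ≤⟨ 5δ+1≤ ∣ X ∣ ∣ Y ∣ (c X Y) δ (nonempty⇒1≤∣∣ neX) (nonempty⇒1≤∣∣ neY) 1≤δ ([∣∣+∣∣]*suc≤ X Y δ≤deg) ⟩
        ∣ X ∣ * δ + ∣ Y ∣ * δ + (c X Y + ∣ Y ∣ * suc δ)
          ≤⟨ +-mono-≤ (+-mono-≤ (independent⇒ (inject₁ i) indepX) (independent⇒ (suc i) indepY)) (+-monoʳ-≤ (c X Y) (∣∣*suc≤w Y δ≤deg)) ⟩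
        ∂ X + ∂ Y + (c X Y + w Y)
          ≤⟨ +-mono-≤ (two-terms≤sum (∂ ∘ A) (inject₁≢suc i)) (drop-q viaY) ⟩
        cut A ∎)
        where X = A (inject₁ i)
              Y = A (suc i)
      ...   | inj₁ viaX = inj₂ (begin
        5 * δ + 1
          ≤⟨ 5δ+1≤ ∣ Y ∣ ∣ X ∣ (c Y X) δ (nonempty⇒1≤∣∣ neY) (nonempty⇒1≤∣∣ neX) 1≤δ ([∣∣+∣∣]*suc≤ Y X δ≤deg) ⟩
        ∣ Y ∣ * δ + ∣ X ∣ * δ + (c Y X + ∣ X ∣ * suc δ)
          ≤⟨ +-mono-≤ (+-mono-≤ (independent⇒ (suc i) indepY) (independent⇒ (inject₁ i) indepX)) (+-mono-≤ (≤-reflexive (c-comm Y X)) (∣∣*suc≤w X δ≤deg)) ⟩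
        ∂ Y + ∂ X + (c X Y + w X)
          ≤⟨ +-mono-≤ (two-terms≤sum (∂ ∘ A) (inject₁≢suc i ∘ sym)) (drop-q viaX) ⟩
        cut A ∎)
        where X = A (inject₁ i)
              Y = A (suc i)

    -- `co-edge` serves the case of a full layer, where the complement has an empty layer and a cut
    -- that is no larger.
    minimum≤cut : ∀ {n} (A : Fin (suc n) → Fin m → Bool) → Edge A → Edge (∁ ∘ A) →
      ((3 * suc n ∸ 2) * L) ⊓ W ⊓ (2 * ξ + 4) ⊓ (5 * δ + 1) ≤ cut A
    minimum≤cut {n} A edge co-edge
      with Fin.all? (λ i → nonempty? (A i)) | Fin.all? (λ i → nonempty? (∁ (A i)))
    ... | yes ne | yes ne∁ = ≤-trans (m⊓n≤m _ (5 * δ + 1)) (≤-trans (m⊓n≤m _ (2 * ξ + 4))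
            (m≤o⊎n≤o⇒m⊓n≤o (all-layers-proper A ne ne∁)))
    ... | no ¬ne | _ with q , empty ← Fin.¬∀⟶∃¬ _ _ (λ i → nonempty? (A i)) ¬ne =
      ≤-trans (⊓-monoˡ-≤ (5 * δ + 1) (m⊓n≤n ((3 * suc n ∸ 2) * L ⊓ W) (2 * ξ + 4)))
        (m≤o⊎n≤o⇒m⊓n≤o (some-layer-empty A q (¬nonempty⇒empty {A q} empty) edge))
    ... | yes _ | no ¬ne∁ with q , full ← Fin.¬∀⟶∃¬ _ _ (λ i → nonempty? (∁ (A i))) ¬ne∁ =
      ≤-trans (⊓-monoˡ-≤ (5 * δ + 1) (m⊓n≤n ((3 * suc n ∸ 2) * L ⊓ W) (2 * ξ + 4)))
        (≤-trans (m≤o⊎n≤o⇒m⊓n≤o (some-layer-empty (∁ ∘ A) q (¬nonempty⇒empty {∁ (A q)} full) co-edge)) (cut-∁ A))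

  -- Cuts of the extremal sets.

  2∂≡ : ∀ X → 2 * ∂ X ≡ sum₂ (λ x y → ⟦ a x y ∧ (X x xor X y) ⟧)
  2∂≡ X = trans (sym (sum₂-double (λ x y → ⟦ a x y ∧ (X x ∧ not (X y)) ⟧))) (sum₂-cong pointwise′)
    where
    pointwise : ∀ e p q → ⟦ e ∧ (p ∧ not q) ⟧ + ⟦ e ∧ (q ∧ not p) ⟧ ≡ ⟦ e ∧ (p xor q) ⟧
    pointwise = toWitness {a? = ∀Bool? λ e → ∀Bool? λ p → ∀Bool? λ q → _ ℕ.≟ _} _
    pointwise′ : ∀ x y → ⟦ a x y ∧ (X x ∧ not (X y)) ⟧ + ⟦ a y x ∧ (X y ∧ not (X x)) ⟧ ≡ ⟦ a x y ∧ (X x xor X y) ⟧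
    pointwise′ x y rewrite a-sym y x = pointwise (a x y) (X x) (X y)

  c-diagonal : ∀ X → c X X ≡ 2 * ∂ X
  c-diagonal X = trans (sum₂-N (λ x y → X x xor X y))
    (trans (cong (_+ sum₂ (λ x y → ⟦ a x y ∧ (X x xor X y) ⟧)) (sum-≡0 (λ x → cong ⟦_⟧ (xor-same (X x)))))
           (sym (2∂≡ X)))

  ∅ : Fin m → Bool
  ∅ _ = false

  ∂∅≡0 : ∂ ∅ ≡ 0
  ∂∅≡0 = sum-≡0 (λ x → sum-≡0 (λ y → cong ⟦_⟧ (∧-zeroʳ (a x y))))

  c∅∅≡0 : c ∅ ∅ ≡ 0
  c∅∅≡0 = trans (c-diagonal ∅) (cong (2 *_) ∂∅≡0)

  c-∅ : ∀ X → c X ∅ ≡ w X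
  c-∅ X = sum₂-cong (λ x y → cong (λ b → ⟦ N x y ∧ b ⟧) (xor-identityʳ (X x)))

  -- The degree sum over `X`: each edge leaving `X` counts once, and each edge inside `X` twice,
  -- once per orientation.
  ∂-volume : ∀ X → ∂ X + sum₂ (λ x y → ⟦ a x y ∧ (X x ∧ X y) ⟧) ≡ sum (λ x → ⟦ X x ⟧ * deg x)
  ∂-volume X = trans (sym (sum₂-+ (λ x y → ⟦ a x y ∧ (X x ∧ not (X y)) ⟧) (λ x y → ⟦ a x y ∧ (X x ∧ X y) ⟧)))
    (trans (sum₂-cong (λ x y → pointwise (a x y) (X x) (X y))) (sum-cong-≗ (λ x → sum-∧ (a x) (X x))))
    where
    pointwise : ∀ e p q → ⟦ e ∧ (p ∧ not q) ⟧ + ⟦ e ∧ (p ∧ q) ⟧ ≡ ⟦ e ∧ p ⟧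
    pointwise = toWitness {a? = ∀Bool? λ e → ∀Bool? λ p → ∀Bool? λ q → _ ℕ.≟ _} _

  ｛_｝ : Fin m → Fin m → Bool
  ｛ x ｝ u = does (x ≟ u)

  ∂-singleton : ∀ x → ∂ ｛ x ｝ ≤ deg x
  ∂-singleton x = ≤-trans (m≤m+n _ _) (≤-reflexive (trans (∂-volume ｛ x ｝) (sum-δ-* x deg)))

  w-singleton : ∀ x → w ｛ x ｝ ≡ suc (deg x)
  w-singleton x = trans (w≡ ｛ x ｝) (sum-δ-* x (suc ∘ deg))

  pair-left : ∀ x y → (｛ x ｝ ∪ ｛ y ｝) x ≡ true
  pair-left x y = cong (_∨ does (y ≟ x)) (dec-true (x ≟ x) refl)

  pair-right : ∀ x y → (｛ x ｝ ∪ ｛ y ｝) y ≡ true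
  pair-right x y = trans (cong (does (x ≟ y) ∨_) (dec-true (y ≟ y) refl)) (∨-zeroʳ (does (x ≟ y)))

  sum-pair : ∀ x y (f : Fin m → ℕ) → sum (λ u → ⟦ (｛ x ｝ ∪ ｛ y ｝) u ⟧ * f u) ≤ f x + f y
  sum-pair x y f = begin
    sum (λ u → ⟦ (｛ x ｝ ∪ ｛ y ｝) u ⟧ * f u)                               ≤⟨ sum-mono (λ u → pointwise (｛ x ｝ u) (｛ y ｝ u) (f u)) ⟩
    sum (λ u → ⟦ ｛ x ｝ u ⟧ * f u + ⟦ ｛ y ｝ u ⟧ * f u)                     ≡⟨ ∑-distrib-+ (λ u → ⟦ ｛ x ｝ u ⟧ * f u) (λ u → ⟦ ｛ y ｝ u ⟧ * f u) ⟩
    sum (λ u → ⟦ ｛ x ｝ u ⟧ * f u) + sum (λ u → ⟦ ｛ y ｝ u ⟧ * f u)         ≡⟨ cong₂ _+_ (sum-δ-* x f) (sum-δ-* y f) ⟩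
    f x + f y                                                               ∎
    where
    open ≤-Reasoning
    pointwise : ∀ p q k → ⟦ p ∨ q ⟧ * k ≤ ⟦ p ⟧ * k + ⟦ q ⟧ * k
    pointwise true  q k = m≤m+n _ _
    pointwise false q k = ≤-refl

  -- Both orientations of the edge `x y` stay inside the pair, so its boundary is at most deg x +
  -- deg y - 2, which absorbs the two units by which the weight exceeds the degrees.
  ∂+w-edge : ∀ {x y} → a x y ≡ true → ∂ (｛ x ｝ ∪ ｛ y ｝) + w (｛ x ｝ ∪ ｛ y ｝) ≤ 2 * (deg x + deg y)
  ∂+w-edge {x} {y} axy = begin
    ∂ X + w X                                   ≤⟨ +-monoʳ-≤ (∂ X) (≤-trans (≤-reflexive (w≡ X)) (sum-pair x y (suc ∘ deg))) ⟩
    ∂ X + (suc (deg x) + suc (deg y))           ≡⟨ rearrange (∂ X) (deg x) (deg y) ⟩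
    ∂ X + 2 + (deg x + deg y)                   ≤⟨ +-monoˡ-≤ (deg x + deg y) (begin
        ∂ X + 2                                                  ≤⟨ +-monoʳ-≤ (∂ X) (≤-trans (+-mono-≤ rowx rowy) (two-terms≤sum rows x≢y)) ⟩
        ∂ X + sum₂ (λ u v → ⟦ a u v ∧ (X u ∧ X v) ⟧)             ≡⟨ ∂-volume X ⟩
        sum (λ u → ⟦ X u ⟧ * deg u)                              ≤⟨ sum-pair x y deg ⟩
        deg x + deg y                                            ∎) ⟩
    deg x + deg y + (deg x + deg y)             ≡⟨ cong (deg x + deg y +_) (+-identityʳ _) ⟨
    2 * (deg x + deg y)                         ∎
    where
    open ≤-Reasoning
    X : Fin m → Bool
    X = ｛ x ｝ ∪ ｛ y ｝
    rows : Fin m → ℕ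
    rows u = sum (λ v → ⟦ a u v ∧ (X u ∧ X v) ⟧)
    rearrange : ∀ a b c → a + (suc b + suc c) ≡ a + 2 + (b + c)
    rearrange = solve-∀
    x≢y : x ≢ y
    x≢y = a⇒≢ axy
    Xx : X x ≡ true
    Xx = pair-left x y
    Xy : X y ≡ true
    Xy = pair-right x y
    row : ∀ {u v} → a u v ≡ true → X u ≡ true → X v ≡ true → 1 ≤ rows u
    row {u} {v} auv Xu Xv = subst (λ b → ⟦ b ⟧ ≤ rows u) (cong₂ _∧_ auv (cong₂ _∧_ Xu Xv)) (term≤sum _ v)
    rowx : 1 ≤ rows x
    rowx = row axy Xx Xy
    rowy : 1 ≤ rows y
    rowy = row (trans (a-sym y x) axy) Xy Xx

  cylinder : ∀ {n} → (Fin m → Bool) → Fin (suc n) → Fin m → Bool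
  cylinder X _ = X

  floor : ∀ {n} → (Fin m → Bool) → Fin (suc n) → Fin m → Bool
  floor X zero    = X
  floor X (suc _) = ∅

  two-floors : ∀ {n} → (Fin m → Bool) → Fin (suc (suc n)) → Fin m → Bool
  two-floors X zero    = X
  two-floors X (suc i) = floor X i

  cut-cylinder : ∀ n X → cut {n} (cylinder X) ≡ (3 * suc n ∸ 2) * ∂ X
  cut-cylinder n X = begin
    sum {suc n} (λ _ → ∂ X) + sum {n} (λ _ → c X X)        ≡⟨ cong₂ _+_ (sum-const (suc n) (∂ X)) (sum-const n (c X X)) ⟩
    suc n * ∂ X + n * c X X                                ≡⟨ cong (λ k → suc n * ∂ X + n * k) (c-diagonal X) ⟩
    suc n * ∂ X + n * (2 * ∂ X)                            ≡⟨ rearrange n (∂ X) ⟩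
    (1 + 3 * n) * ∂ X                                      ≡⟨ cong (λ k → (k ∸ 2) * ∂ X) (*-suc 3 n) ⟨
    (3 * suc n ∸ 2) * ∂ X                                  ∎
    where
    open ≡-Reasoning
    rearrange : ∀ n k → suc n * k + n * (2 * k) ≡ (1 + 3 * n) * k
    rearrange = solve-∀

  cut-floor : ∀ n X → cut {suc n} (floor X) ≡ ∂ X + w X
  cut-floor n X = cong₂ _+_
    (trans (cong (∂ X +_) (sum-≡0 {suc n} (λ _ → ∂∅≡0))) (+-identityʳ _))
    (trans (cong₂ _+_ (c-∅ X) (sum-≡0 {n} (λ _ → c∅∅≡0))) (+-identityʳ _))

  cut-two-floors : ∀ n X → cut {suc (suc n)} (two-floors X) ≡ ∂ X + c X X + (∂ X + w X)
  cut-two-floors n X = trans (rearrange (∂ X) _ (c X X) _) (cong (∂ X + c X X +_) (cut-floor n X))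
    where
    rearrange : ∀ a b c d → a + b + (c + d) ≡ a + c + (b + d)
    rearrange = solve-∀

  ∂full≡0 : ∂ (∁ ∅) ≡ 0
  ∂full≡0 = n≤0⇒n≡0 (≤-trans (∂-∁ ∅) (≤-reflexive ∂∅≡0))

  w-full : w (∁ ∅) ≡ W
  w-full = sum₂-cong (λ x y → cong ⟦_⟧ (∧-identityʳ (N x y)))

-- Lengths of filtered lists as sums.

module _ {A : Set} {P : A → Set} (P? : ∀ x → Dec (P x)) where

  length-filter-tabulate : ∀ {n} (f : Fin n → A) →
    length (filter P? (tabulate f)) ≡ sum (λ i → ⟦ does (P? (f i)) ⟧)
  length-filter-tabulate {zero}  f = refl
  length-filter-tabulate {suc n} f with does (P? (f zero))
  ... | true  = cong suc (length-filter-tabulate (f ∘ suc))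
  ... | false = length-filter-tabulate (f ∘ suc)

  length-filter-filter : ∀ {Q : A → Set} (Q? : ∀ x → Dec (Q x)) xs →
    length (filter P? (filter Q? xs)) ≡ length (filter (λ x → Q? x ×-dec P? x) xs)
  length-filter-filter Q? []       = refl
  length-filter-filter Q? (x ∷ xs) with does (Q? x)
  ... | false = length-filter-filter Q? xs
  ... | true with does (P? x)
  ...   | true  = cong suc (length-filter-filter Q? xs)
  ...   | false = length-filter-filter Q? xs

length-filter-cartesianProduct : ∀ {A B : Set} {P : A × B → Set} (P? : ∀ x → Dec (P x))
  {m n} (f : Fin m → A) (g : Fin n → B) →
  length (filter P? (cartesianProduct (tabulate f) (tabulate g))) ≡ sum₂ (λ i j → ⟦ does (P? (f i , g j)) ⟧)
length-filter-cartesianProduct P? {zero}  f g = refl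
length-filter-cartesianProduct P? {suc m} f g = begin
  length (filter P? (map (f zero ,_) (tabulate g) ++ rest))                       ≡⟨ cong length (filter-++ P? (map (f zero ,_) (tabulate g)) rest) ⟩
  length (filter P? (map (f zero ,_) (tabulate g)) ++ filter P? rest)             ≡⟨ length-++ (filter P? (map (f zero ,_) (tabulate g))) ⟩
  length (filter P? (map (f zero ,_) (tabulate g))) + length (filter P? rest)     ≡⟨ cong₂ _+_
    (trans (cong (length ∘ filter P?) (map-tabulate g (f zero ,_))) (length-filter-tabulate P? (λ j → f zero , g j)))
    (length-filter-cartesianProduct P? (f ∘ suc) g) ⟩
  sum₂ (λ i j → ⟦ does (P? (f i , g j)) ⟧)                                        ∎
  where
  open ≡-Reasoning
  rest = cartesianProduct (tabulate (f ∘ suc)) (tabulate g)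

-- Off the diagonal exactly one order of a pair is increasing. Doubling thus trades the index order
-- used in `edges` for a symmetric sum over all pairs.
2*sum₂-< : ∀ {n} (s : Fin n → Fin n → Bool) → (∀ i j → s i j ≡ s j i) → (∀ i → s i i ≡ false) →
  2 * sum₂ (λ i j → ⟦ does (i Fin.<? j) ∧ s i j ⟧) ≡ sum₂ (λ i j → ⟦ s i j ⟧)
2*sum₂-< s s-sym s-irrefl = trans (sym (sum₂-double (λ i j → ⟦ does (i Fin.<? j) ∧ s i j ⟧))) (sum₂-cong pointwise)
  where
  pointwise : ∀ i j → ⟦ does (i Fin.<? j) ∧ s i j ⟧ + ⟦ does (j Fin.<? i) ∧ s j i ⟧ ≡ ⟦ s i j ⟧
  pointwise i j with Fin.<-cmp i j
  ... | tri< i<j _ j≮i rewrite dec-true (i Fin.<? j) i<j | dec-false (j Fin.<? i) j≮i = +-identityʳ _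
  ... | tri> i≮j _ j<i rewrite dec-false (i Fin.<? j) i≮j | dec-true (j Fin.<? i) j<i = cong ⟦_⟧ (s-sym j i)
  ... | tri≈ i≮j refl _ rewrite dec-false (i Fin.<? i) i≮j | s-irrefl i = refl

does-implied : ∀ {P Q : Set} (P? : Dec P) (Q? : Dec Q) → (P → Q) → ⟦ does P? ⟧ ≤ ⟦ does Q? ⟧
does-implied (no _)  Q?       f = z≤n
does-implied (yes p) (yes _)  f = ≤-refl
does-implied (yes p) (no ¬q)  f = contradiction (f p) ¬q

¬xor⇒≡ : ∀ p q → ¬ T (p xor q) → p ≡ q
¬xor⇒≡ true  true  _ = refl
¬xor⇒≡ true  false h = contradiction _ h
¬xor⇒≡ false true  h = contradiction _ h
¬xor⇒≡ false false _ = refl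

-- Edge cuts as boundaries of vertex sets.

module Cuts (K : Graph) where
  open Graph K

  vertex : Fin order → V
  vertex = Inverse.from enum

  index-vertex : ∀ i → index (vertex i) ≡ i
  index-vertex = Inverse.strictlyInverseˡ enum

  vertex-index : ∀ v → vertex (index v) ≡ v
  vertex-index = Inverse.strictlyInverseʳ enum

  a : Fin order → Fin order → Bool
  a i j = does (adj? (vertex i) (vertex j))

  a-sym : ∀ i j → a i j ≡ a j i
  a-sym i j = does-⇔ (mk⇔ sym-Adj sym-Adj) (adj? (vertex i) (vertex j)) (adj? (vertex j) (vertex i))

  a-irrefl : ∀ i → a i i ≡ false
  a-irrefl i = dec-false (adj? (vertex i) (vertex i)) (irrefl-Adj refl)

  open Layers a a-sym a-irrefl public

  a-index : ∀ {u v} → Adj u v → a (index u) (index v) ≡ true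
  a-index {u} {v} uv = dec-true (adj? _ _) (subst₂ Adj (sym (vertex-index u)) (sym (vertex-index v)) uv)

  a⇒Adj : ∀ {i j} → a i j ≡ true → Adj (vertex i) (vertex j)
  a⇒Adj {i} {j} aij with adj? (vertex i) (vertex j)
  ... | yes ij = ij

  vertices≡tabulate : vertices ≡ tabulate vertex
  vertices≡tabulate = map-tabulate id vertex

  deg≡degree : ∀ i → deg i ≡ degree (vertex i)
  deg≡degree i = sym (trans (cong (length ∘ filter (adj? (vertex i))) vertices≡tabulate)
    (length-filter-tabulate (adj? (vertex i)) vertex))

  deg-index≡degree : ∀ v → deg (index v) ≡ degree v
  deg-index≡degree v = trans (deg≡degree (index v)) (cong degree (vertex-index v))

  2*e : 2 * e ≡ sum deg
  2*e = trans (cong (2 *_) e≡) (2*sum₂-< a a-sym a-irrefl)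
    where
    P? = λ ((u , v) : V × V) → (index u Fin.<? index v) ×-dec adj? u v
    e≡ : e ≡ sum₂ (λ i j → ⟦ does (i Fin.<? j) ∧ a i j ⟧)
    e≡ = trans (cong (λ vs → length (filter P? (cartesianProduct vs vs))) vertices≡tabulate)
      (trans (length-filter-cartesianProduct P? vertex vertex)
        (sum₂-cong (λ i j → cong₂ (λ k l → ⟦ does (k Fin.<? l) ∧ a i j ⟧) (index-vertex i) (index-vertex j))))

  2*size : ∀ (S : EdgeSet K) → let open EdgeSet S in 2 * size ≡ sum₂ (λ i j → ⟦ does (mem? (vertex i) (vertex j)) ⟧)
  2*size S = trans (cong (2 *_) size≡) (2*sum₂-< s
      (λ i j → does-⇔ (mk⇔ sym-Mem sym-Mem) (mem? (vertex i) (vertex j)) (mem? (vertex j) (vertex i)))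
      (λ i → dec-false (mem? (vertex i) (vertex i)) (irrefl-Adj refl ∘ Mem⊆Adj)))
    where
    open EdgeSet S
    s : Fin order → Fin order → Bool
    s i j = does (mem? (vertex i) (vertex j))
    P? = λ ((u , v) : V × V) → (index u Fin.<? index v) ×-dec adj? u v
    Q? = λ ((u , v) : V × V) → P? (u , v) ×-dec mem? u v
    drop-adj : ∀ u v (i j : Fin order) → (does (i Fin.<? j) ∧ does (adj? u v)) ∧ does (mem? u v) ≡ does (i Fin.<? j) ∧ does (mem? u v)
    drop-adj u v i j with mem? u v
    ... | yes uv rewrite dec-true (adj? u v) (Mem⊆Adj uv) = cong (_∧ true) (∧-identityʳ (does (i Fin.<? j)))
    ... | no _   = trans (∧-zeroʳ _) (sym (∧-zeroʳ _))
    size≡ : size ≡ sum₂ (λ i j → ⟦ does (i Fin.<? j) ∧ s i j ⟧)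
    size≡ = trans (length-filter-filter (uncurry mem?) P? (cartesianProduct vertices vertices))
      (trans (cong (λ vs → length (filter Q? (cartesianProduct vs vs))) vertices≡tabulate)
      (trans (length-filter-cartesianProduct Q? vertex vertex)
        (sum₂-cong (λ i j → trans (cong₂ (λ k l → ⟦ does (Q′ i j k l) ⟧) (index-vertex i) (index-vertex j))
          (cong ⟦_⟧ (drop-adj (vertex i) (vertex j) i j))))))
      where
      Q′ = λ i j k l → ((k Fin.<? l) ×-dec adj? (vertex i) (vertex j)) ×-dec mem? (vertex i) (vertex j)

  size-mono : ∀ (S S′ : EdgeSet K) → (∀ {u v} → EdgeSet.Mem S u v → EdgeSet.Mem S′ u v) → EdgeSet.size S ≤ EdgeSet.size S′
  size-mono S S′ S⊆S′ = *-cancelˡ-≤ 2 (begin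
    2 * EdgeSet.size S                                            ≡⟨ 2*size S ⟩
    sum₂ (λ i j → ⟦ does (EdgeSet.mem? S (vertex i) (vertex j)) ⟧)  ≤⟨ sum₂-mono (λ i j → does-implied (EdgeSet.mem? S (vertex i) (vertex j)) (EdgeSet.mem? S′ (vertex i) (vertex j)) S⊆S′) ⟩
    sum₂ (λ i j → ⟦ does (EdgeSet.mem? S′ (vertex i) (vertex j)) ⟧) ≡⟨ 2*size S′ ⟨
    2 * EdgeSet.size S′                                           ∎)
    where open ≤-Reasoning

  boundary : (V → Bool) → EdgeSet K
  boundary B = record
    { Mem     = λ u v → Adj u v × T (B u xor B v)
    ; mem?    = λ u v → adj? u v ×-dec T? (B u xor B v)
    ; sym-Mem = λ {u} {v} (uv , d) → sym-Adj uv , subst T (xor-comm (B u) (B v)) d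
    ; Mem⊆Adj = proj₁
    }

  boundary-invariant : ∀ B {u v} → Star (Graph.Adj (K − boundary B)) u v → B u ≡ B v
  boundary-invariant B ε = refl
  boundary-invariant B {u} ((uv , ∉) ◅ p) = trans (¬xor⇒≡ (B u) _ (λ d → ∉ (uv , d))) (boundary-invariant B p)

  boundary-cut : ∀ B {u v} → B u ≡ true → B v ≡ false → IsEdgeCut K (boundary B)
  boundary-cut B {u} {v} Bu Bv conn with () ← trans (sym Bu) (trans (boundary-invariant B (conn u v)) Bv)

  -- An edge to a vertex on the same side survives the removal of the boundary, so no component is a
  -- single vertex.
  boundary-restricted : ∀ B {u v} → B u ≡ true → B v ≡ false → (∀ x → ∃ λ y → Adj x y × B x ≡ B y) →
    IsRestrictedEdgeCut K (boundary B)
  boundary-restricted B Bu Bv mate = boundary-cut B Bu Bv , λ x → let y , xy , Bx≡By = mate x in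
    x , y , ε , (xy , λ (_ , d) → subst T (trans (cong (_xor B y) Bx≡By) (xor-same (B y))) d) ◅ ε ,
    λ x≡y → irrefl-Adj x≡y xy

  -- A proper nonempty union of components of `K − S`. All edges leaving it belong to `S`, so a
  -- lower bound for boundaries is one for cuts.
  record Side (S : EdgeSet K) : Set where
    field
      B        : V → Bool
      inside   : ∃ λ u → B u ≡ true
      outside  : ∃ λ v → B v ≡ false
      closed   : ∀ {u v} → Graph.Adj (K − S) u v → B u ≡ B v

    boundary≤ : EdgeSet.size (boundary B) ≤ EdgeSet.size S
    boundary≤ = size-mono (boundary B) S (λ {u} {v} (uv , d) →
      decidable-stable (EdgeSet.mem? S u v) (λ ∉ → subst T (trans (cong (_xor B v) (closed (uv , ∉))) (xor-same (B v))) d))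

  -- Reachability is decided only up to double negation; this suffices since Side is used to prove decidable statements.
  edge-cut⇒¬¬Side : ∀ S → IsEdgeCut K S → ¬ ¬ Side S
  edge-cut⇒¬¬Side S ¬conn = ¬¬-map side (¬¬-∀ λ i → ¬¬-∀ λ j → ¬¬-excluded-middle)
    where
    Reach = Graph.Component (K − S)
    ¬¬-∀ : ∀ {n} {P : Fin n → Set} → (∀ i → ¬ ¬ P i) → ¬ ¬ (∀ i → P i)
    ¬¬-∀ = Fin.sequence (RawMonad.rawApplicative ¬¬-Monad)
    side : (∀ i j → Dec (Reach (vertex i) (vertex j))) → Side S
    side reach? with Fin.all? (λ i → Fin.all? (reach? i))
    ... | yes all = contradiction (λ u v → subst₂ Reach (vertex-index u) (vertex-index v) (all (index u) (index v))) ¬conn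
    ... | no ¬all with i , ¬all′ ← Fin.¬∀⟶∃¬ _ _ (λ i → Fin.all? (reach? i)) ¬all
                  with j , ¬ij ← Fin.¬∀⟶∃¬ _ _ (reach? i) ¬all′ = record
      { B       = λ v → does (from-i v)
      ; inside  = vertex i , dec-true (from-i (vertex i)) ε
      ; outside = vertex j , dec-false (from-i (vertex j)) ¬ij
      ; closed  = λ {u} {v} uv → does-⇔ (mk⇔ (_◅◅ uv ◅ ε) (_◅◅ Graph.sym-Adj (K − S) uv ◅ ε)) (from-i u) (from-i v)
      }
      where
      from-i : ∀ v → Dec (Reach (vertex i) v)
      from-i v = map′ (subst (Reach (vertex i)) (vertex-index v)) (subst (Reach (vertex i)) (sym (vertex-index v))) (reach? i (index v))

  at-least-two⇒neighbour : ∀ {v} → AtLeastTwo (Component v) → ∃ λ u → Adj v u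
  at-least-two⇒neighbour (x , y , (_◅_ {j = u} vu _) , _ , _)   = u , vu
  at-least-two⇒neighbour (x , y , ε , (_◅_ {j = u} vu _) , _)   = u , vu
  at-least-two⇒neighbour (x , y , ε , ε , x≢y)                  = contradiction refl x≢y

  size-boundary≡∂ : ∀ B X → (∀ x → B (vertex x) ≡ X x) → EdgeSet.size (boundary B) ≡ ∂ X
  size-boundary≡∂ B X B≡X = *-cancelˡ-≡ _ _ 2 (trans (2*size (boundary B))
    (trans (sum₂-cong (λ x y → cong₂ (λ p q → ⟦ a x y ∧ (p xor q) ⟧) (B≡X x) (B≡X y))) (sym (2∂≡ X))))

-- The strong product with a path, layer by layer.

consecutive : ∀ {n} {i j : Fin (suc n)} → suc (toℕ i) ≡ toℕ j → ∃ λ k → i ≡ inject₁ k × j ≡ suc k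
consecutive {i = i} {j = suc k} e =
  k , Fin.toℕ-injective (trans (suc-injective e) (sym (Fin.toℕ-inject₁ k))) , refl

module StrongProduct (G : Graph) (n : ℕ) where
  private
    module G = Graph G
    P H : Graph
    P = Path (suc n)
    H = G ⊠ P
    module P = Graph P
    module H = Graph H
    module CH = Cuts H
  open Cuts G

  pair : Fin G.order → Fin (suc n) → Fin H.order
  pair = combine

  vertex-pair : ∀ k i → CH.vertex (pair k i) ≡ (vertex k , i)
  vertex-pair k i = cong (λ (k , i) → vertex k , i) (Fin.remQuot-combine {G.order} {suc n} k i)

  -- The numbering of the product has the vertex of `G` as outer index; the three interchanges move
  -- both layer indices outside.
  sum₂-layers : ∀ (f : H.V → H.V → ℕ) → sum₂ (λ k l → f (CH.vertex k) (CH.vertex l)) ≡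
    sum₂ (λ i j → sum₂ (λ x y → f (vertex x , i) (vertex y , j)))
  sum₂-layers f = begin
    sum₂ (λ k l → f (CH.vertex k) (CH.vertex l))
      ≡⟨ sum-combine G.order (λ k → sum (λ l → f (CH.vertex k) (CH.vertex l))) ⟩
    sum₂ (λ x i → sum (λ l → f (CH.vertex (pair x i)) (CH.vertex l)))
      ≡⟨ sum₂-cong (λ x i → sum-combine G.order (λ l → f (CH.vertex (pair x i)) (CH.vertex l))) ⟩
    sum₂ (λ x i → sum₂ (λ y j → f (CH.vertex (pair x i)) (CH.vertex (pair y j))))
      ≡⟨ sum₂-cong (λ x i → sum₂-cong (λ y j → cong₂ f (vertex-pair x i) (vertex-pair y j))) ⟩
    sum₂ (λ x i → sum₂ (λ y j → f (vertex x , i) (vertex y , j)))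
      ≡⟨ ∑-comm (λ x i → sum₂ (λ y j → f (vertex x , i) (vertex y , j))) ⟩
    sum₂ (λ i x → sum₂ (λ y j → f (vertex x , i) (vertex y , j)))
      ≡⟨ sum₂-cong (λ i x → ∑-comm (λ y j → f (vertex x , i) (vertex y , j))) ⟩
    sum₂ (λ i x → sum₂ (λ j y → f (vertex x , i) (vertex y , j)))
      ≡⟨ sum-cong-≗ (λ i → ∑-comm (λ x j → sum (λ y → f (vertex x , i) (vertex y , j)))) ⟩
    sum₂ (λ i j → sum₂ (λ x y → f (vertex x , i) (vertex y , j))) ∎
    where open ≡-Reasoning

  adj-horizontal : ∀ i x y → does (H.adj? (vertex x , i) (vertex y , i)) ≡ a x y
  adj-horizontal i x y = does-⇔ (mk⇔ to from) (H.adj? (vertex x , i) (vertex y , i)) (G.adj? (vertex x) (vertex y))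
    where
    to : H.Adj (vertex x , i) (vertex y , i) → G.Adj (vertex x) (vertex y)
    to (inj₁ (_ , ii))        = contradiction ii (P.irrefl-Adj {i} refl)
    to (inj₂ (inj₁ (_ , xy))) = xy
    to (inj₂ (inj₂ (xy , _))) = xy
    from : G.Adj (vertex x) (vertex y) → H.Adj (vertex x , i) (vertex y , i)
    from xy = inj₂ (inj₁ (refl , xy))

  adj-between : ∀ {i j} x y → P.Adj i j → does (H.adj? (vertex x , i) (vertex y , j)) ≡ N x y
  adj-between {i} {j} x y ij = does-⇔ (mk⇔ to from) (H.adj? (vertex x , i) (vertex y , j)) ((x ≟ y) ⊎-dec G.adj? (vertex x) (vertex y))
    where
    to : H.Adj (vertex x , i) (vertex y , j) → x ≡ y ⊎ G.Adj (vertex x) (vertex y)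
    to (inj₁ (x≡y , _))       = inj₁ (trans (sym (index-vertex x)) (trans (cong G.index x≡y) (index-vertex y)))
    to (inj₂ (inj₁ (i≡j , _))) = contradiction ij (P.irrefl-Adj i≡j)
    to (inj₂ (inj₂ (xy , _))) = inj₂ xy
    from : x ≡ y ⊎ G.Adj (vertex x) (vertex y) → H.Adj (vertex x , i) (vertex y , j)
    from (inj₁ x≡y) = inj₁ (cong vertex x≡y , ij)
    from (inj₂ xy)  = inj₂ (inj₂ (xy , ij))

  adj-distant : ∀ {i j} x y → i ≢ j → ¬ P.Adj i j → does (H.adj? (vertex x , i) (vertex y , j)) ≡ false
  adj-distant {i} {j} x y i≢j ¬ij = dec-false (H.adj? (vertex x , i) (vertex y , j)) λ where
    (inj₁ (_ , ij))        → ¬ij ij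
    (inj₂ (inj₁ (i≡j , _))) → i≢j i≡j
    (inj₂ (inj₂ (_ , ij))) → ¬ij ij

  link : ∀ (i : Fin n) → P.Adj (inject₁ i) (suc i)
  link i = inj₁ (cong suc (Fin.toℕ-inject₁ i))

  -- Over all ordered pairs of vertices, the block of a layer with itself gives twice its `∂`, each
  -- link gives `c` once per direction, and blocks of distant layers vanish. The factor 2 then
  -- cancels.
  size-boundary≡cut : ∀ (B : H.V → Bool) A → (∀ i x → B (vertex x , i) ≡ A i x) →
    EdgeSet.size (CH.boundary B) ≡ cut A
  size-boundary≡cut B A B≡A = *-cancelˡ-≡ _ _ 2 (begin
    2 * EdgeSet.size (CH.boundary B)
      ≡⟨ CH.2*size (CH.boundary B) ⟩
    sum₂ (λ k l → ⟦ does (H.adj? (CH.vertex k) (CH.vertex l)) ∧ (B (CH.vertex k) xor B (CH.vertex l)) ⟧)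
      ≡⟨ sum₂-layers (λ u v → ⟦ does (H.adj? u v) ∧ (B u xor B v) ⟧) ⟩
    sum₂ (λ i j → sum₂ (λ x y → ⟦ does (H.adj? (vertex x , i) (vertex y , j)) ∧ (B (vertex x , i) xor B (vertex y , j)) ⟧))
      ≡⟨ sum₂-cong (λ i j → sum₂-cong (λ x y → cong₂ (λ p q → ⟦ does (H.adj? (vertex x , i) (vertex y , j)) ∧ (p xor q) ⟧) (B≡A i x) (B≡A j y))) ⟩
    sum₂ F
      ≡⟨ tridiagonal-sum F (λ i j i≢j ¬ij → sum-≡0 (λ x → sum-≡0 (λ y → cong (λ b → ⟦ b ∧ (A i x xor A j y) ⟧) (adj-distant x y i≢j ¬ij)))) ⟩
    sum (λ i → F i i) + (links F + links (λ i j → F j i))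
      ≡⟨ cong₂ _+_ (sum-cong-≗ F-diagonal)
           (cong₂ _+_ (sum-cong-≗ (λ i → F-link (link i)))
                      (sum-cong-≗ (λ i → trans (F-link (P.sym-Adj (link i))) (c-comm (A (suc i)) (A (inject₁ i)))))) ⟩
    sum (λ i → 2 * ∂ (A i)) + (links (λ i j → c (A i) (A j)) + links (λ i j → c (A i) (A j)))
      ≡⟨ cong₂ _+_ (sym (*-distribˡ-sum 2 (∂ ∘ A))) (cong (links (λ i j → c (A i) (A j)) +_) (sym (+-identityʳ _))) ⟩
    2 * sum (λ i → ∂ (A i)) + 2 * links (λ i j → c (A i) (A j))
      ≡⟨ *-distribˡ-+ 2 (sum (λ i → ∂ (A i))) _ ⟨
    2 * cut A ∎)
    where
    open ≡-Reasoning
    F : Fin (suc n) → Fin (suc n) → ℕ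
    F i j = sum₂ (λ x y → ⟦ does (H.adj? (vertex x , i) (vertex y , j)) ∧ (A i x xor A j y) ⟧)
    F-diagonal : ∀ i → F i i ≡ 2 * ∂ (A i)
    F-diagonal i = trans (sum₂-cong (λ x y → cong (λ b → ⟦ b ∧ (A i x xor A i y) ⟧) (adj-horizontal i x y))) (sym (2∂≡ (A i)))
    F-link : ∀ {i j} → P.Adj i j → F i j ≡ c (A i) (A j)
    F-link {i} {j} ij = sum₂-cong (λ x y → cong (λ b → ⟦ b ∧ (A i x xor A j y) ⟧) (adj-between x y ij))

  edge⇒Edge : ∀ (B : H.V → Bool) {u v} → H.Adj u v → B u ≡ true → B v ≡ true → Edge (λ i x → B (vertex x , i))
  edge⇒Edge B {x , i} {y , j} uv Bu Bv = go uv
    where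
    at-index : ∀ {x i} → B (x , i) ≡ true → B (vertex (G.index x) , i) ≡ true
    at-index {x} {i} = trans (cong (λ x → B (x , i)) (vertex-index x))
    consecutive⇒ : ∀ {x y i j} → B (x , i) ≡ true → B (y , j) ≡ true → suc (toℕ i) ≡ toℕ j → Edge (λ i x → B (vertex x , i))
    consecutive⇒ {x} {y} Bu Bv e with k , refl , refl ← consecutive e =
      between k (G.index x , at-index Bu) (G.index y , at-index Bv)
    vertical : P.Adj i j → Edge (λ i x → B (vertex x , i))
    vertical (inj₁ e) = consecutive⇒ Bu Bv e
    vertical (inj₂ e) = consecutive⇒ Bv Bu e
    go : H.Adj (x , i) (y , j) → Edge (λ i x → B (vertex x , i))
    go (inj₁ (_ , ij))           = vertical ij
    go (inj₂ (inj₁ (refl , xy))) = within i (a-index xy) (at-index Bu) (at-index Bv)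
    -- A diagonal edge is recorded like a vertical one, since `between` keeps only the two layers.
    go (inj₂ (inj₂ (_ , ij)))    = vertical ij

  -- A neighbour on the same side, as `boundary-restricted` asks for.
  data Mate (A : Fin (suc n) → Fin G.order → Bool) (i : Fin (suc n)) (x : Fin G.order) : Set where
    horizontal : ∀ y → a x y ≡ true → A i x ≡ A i y → Mate A i x
    vertical   : ∀ j → P.Adj i j → A i x ≡ A j x → Mate A i x

  layers⇒restricted-cut : ∀ A → (∃ λ i → Nonempty (A i)) → (∃ λ i → Nonempty (∁ (A i))) → (∀ i x → Mate A i x) →
    ∃ λ S → IsRestrictedEdgeCut H S × EdgeSet.size S ≡ cut A
  layers⇒restricted-cut A (i , x , Ax) (j , y , ∁Ay) mate = CH.boundary B ,
      CH.boundary-restricted B {vertex x , i} {vertex y , j}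
        (trans (B≡A i x) Ax) (trans (B≡A j y) (trans (sym (not-involutive (A j y))) (cong not ∁Ay))) mate′ ,
      size-boundary≡cut B A B≡A
    where
    B : H.V → Bool
    B (x , i) = A i (G.index x)
    B≡A : ∀ i x → B (vertex x , i) ≡ A i x
    B≡A i x = cong (A i) (index-vertex x)
    mate′ : ∀ u → ∃ λ v → H.Adj u v × B u ≡ B v
    mate′ (x , i) with mate i (G.index x)
    ... | horizontal y xy e = (vertex y , i) , inj₂ (inj₁ (refl , subst (λ x → G.Adj x (vertex y)) (vertex-index x) (a⇒Adj xy))) ,
                              trans e (sym (B≡A i y))
    ... | vertical j ij e   = (x , j) , inj₁ (refl , ij) , e

-- Attaining the minimum and concluding.

-- With `≤`, upper bounds for the candidate cuts are enough; equality for the minimum follows by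
-- antisymmetry from the lower bound.
Attained : Graph → ℕ → Set₁
Attained H k = ∃ λ S → IsRestrictedEdgeCut H S × EdgeSet.size S ≤ k

another : ∀ {n} → 2 ≤ n → (k : Fin n) → ∃ λ l → k ≢ l
another (s≤s (s≤s _)) zero    = suc zero , λ ()
another (s≤s (s≤s _)) (suc k) = zero , λ ()

module _ (G : Graph) (connected : Graph.Connected G) (nontrivial : Graph.Nontrivial G) (n : ℕ)
         (L ξ δ : ℕ) (isL : IsEdgeConnectivity G L) (isξ : IsMinEdgeDegree G ξ) (isδ : IsMinDegree G δ) where
  private
    module G = Graph G
    H : Graph
    H = G ⊠ Path (suc (suc n))
    module CH = Cuts H
    minimum : ℕ
    minimum = ((3 * suc (suc n) ∸ 2) * L) ⊓ (G.order + 2 * G.e) ⊓ (2 * ξ + 4) ⊓ (5 * δ + 1)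
  open Cuts G
  open StrongProduct G (suc n)

  W≡m+2e : W ≡ G.order + 2 * G.e
  W≡m+2e = trans W≡m+∑deg (cong (G.order +_) (sym 2*e))

  neighbour : ∀ x → ∃ λ y → a x y ≡ true
  neighbour x with y , x≢y ← another nontrivial x
    with u , xu ← at-least-two⇒neighbour {vertex x} (vertex x , vertex y , ε , connected _ _ ,
      λ e → x≢y (trans (sym (index-vertex x)) (trans (cong G.index e) (index-vertex y))))
    = G.index u , dec-true (G.adj? (vertex x) _) (subst (G.Adj (vertex x)) (sym (vertex-index u)) xu)

  1≤deg : ∀ x → 1 ≤ deg x
  1≤deg x with y , axy ← neighbour x = subst (λ b → ⟦ b ⟧ ≤ deg x) axy (term≤sum _ y)

  δ≤deg : ∀ x → δ ≤ deg x
  δ≤deg x = subst (δ ≤_) (sym (deg≡degree x)) (proj₂ isδ (vertex x) _)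

  minimum-degree : ∃ λ x → deg x ≡ δ
  minimum-degree with v , _ , eq ← proj₁ isδ = G.index v , trans (deg-index≡degree v) eq

  1≤δ : 1 ≤ δ
  1≤δ with x , eq ← minimum-degree = subst (1 ≤_) eq (1≤deg x)

  ξ+2≤deg+deg : ∀ {x y} → a x y ≡ true → ξ + 2 ≤ deg x + deg y
  ξ+2≤deg+deg {x} {y} axy = m≤o∸n⇒m+n≤o ξ (+-mono-≤ (1≤deg x) (1≤deg y))
    (subst₂ (λ j k → ξ ≤ j + k ∸ 2) (sym (deg≡degree x)) (sym (deg≡degree y))
      (proj₂ isξ (vertex x , vertex y) (a⇒Adj axy)))

  minimum-edge-degree : ∃ λ x → ∃ λ y → a x y ≡ true × deg x + deg y ≡ ξ + 2
  minimum-edge-degree with (u , v) , uv , eq ← proj₁ isξ = x , y , a-index uv ,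
      trans (sym (m∸n+n≡m (+-mono-≤ (1≤deg x) (1≤deg y))))
        (cong (_+ 2) (trans (cong₂ (λ j k → j + k ∸ 2) (deg-index≡degree u) (deg-index≡degree v)) eq))
    where x = G.index u
          y = G.index v

  L≤∂ : ∀ X → Nonempty X → Nonempty (∁ X) → L ≤ ∂ X
  L≤∂ X (x , Xx) (y , ∁Xy) = subst (L ≤_) (size-boundary≡∂ (X ∘ G.index) X B≡X)
    (proj₂ isL (boundary (X ∘ G.index)) (boundary-cut (X ∘ G.index) {vertex x} {vertex y}
      (trans (B≡X x) Xx) (trans (B≡X y) (trans (sym (not-involutive (X y))) (cong not ∁Xy)))))
    where
    B≡X : ∀ x → X (G.index (vertex x)) ≡ X x
    B≡X x = cong X (index-vertex x)

  singleton-nonempty : ∀ x → Nonempty ｛ x ｝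
  singleton-nonempty x = x , dec-true (x ≟ x) refl

  ∁singleton-nonempty : ∀ x → Nonempty (∁ ｛ x ｝)
  ∁singleton-nonempty x with y , axy ← neighbour x = y , cong not (dec-false (x ≟ y) (a⇒≢ axy))

  L≤δ : L ≤ δ
  L≤δ with x , refl ← minimum-degree =
    ≤-trans (L≤∂ ｛ x ｝ (singleton-nonempty x) (∁singleton-nonempty x)) (∂-singleton x)

  -- A side of a minimum cut is available only under double negation. Encoding it as a `Subset`
  -- makes its existence a finite search, hence decidable and stable, and so yields an actual set.
  minimum-cut : ∃ λ X → Nonempty X × Nonempty (∁ X) × ∂ X ≤ L
  minimum-cut with S , cutS , refl ← proj₁ isL =
    let s , P = decidable-stable (anySubset? P?) (¬¬-map from-side (edge-cut⇒¬¬Side S cutS)) in lookup s , P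
    where
    P? : ∀ (s : Subset G.order) → Dec (Nonempty (lookup s) × Nonempty (∁ (lookup s)) × ∂ (lookup s) ≤ EdgeSet.size S)
    P? s = nonempty? (lookup s) ×-dec nonempty? (∁ (lookup s)) ×-dec (∂ (lookup s) ≤? EdgeSet.size S)
    from-side : Side S → ∃ λ (s : Subset G.order) → Nonempty (lookup s) × Nonempty (∁ (lookup s)) × ∂ (lookup s) ≤ EdgeSet.size S
    from-side side = s , (G.index u , trans (s-index u) Bu) , (G.index v , cong not (trans (s-index v) Bv)) ,
        subst (_≤ EdgeSet.size S) (size-boundary≡∂ B (lookup s) (λ x → sym (lookup∘tabulate (B ∘ vertex) x))) boundary≤
      where
      open Side side
      s = Vec.tabulate (B ∘ vertex)
      u = proj₁ inside
      Bu = proj₂ inside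
      v = proj₁ outside
      Bv = proj₂ outside
      s-index : ∀ v → lookup s (G.index v) ≡ B v
      s-index v = trans (lookup∘tabulate (B ∘ vertex) (G.index v)) (cong B (vertex-index v))

  attain : ∀ {k} A → (∃ λ i → Nonempty (A i)) → (∃ λ i → Nonempty (∁ (A i))) → (∀ i x → Mate A i x) →
    cut A ≤ k → Attained H k
  attain A ne ne∁ mate cut≤ with S , restricted , eq ← layers⇒restricted-cut A ne ne∁ mate =
    S , restricted , ≤-trans (≤-reflexive eq) cut≤

  sideways : ∀ A i x → (∀ y → A i x ≡ A i y) → Mate A i x
  sideways A i x constant = let y , axy = neighbour x in horizontal y axy (constant y)

  attained-cylinder : Attained H ((3 * suc (suc n) ∸ 2) * L)
  attained-cylinder with X , ne , ne∁ , ∂X≤L ← minimum-cut = attain (cylinder X) (zero , ne) (zero , ne∁) mate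
      (≤-trans (≤-reflexive (cut-cylinder (suc n) X)) (*-monoʳ-≤ (3 * suc (suc n) ∸ 2) ∂X≤L))
    where
    mate : ∀ i x → Mate (cylinder X) i x
    mate zero    x = vertical (suc zero) (link zero) refl
    mate (suc i) x = vertical (inject₁ i) (Graph.sym-Adj (Path (suc (suc n))) (link i)) refl

  attained-floor : Attained H (G.order + 2 * G.e)
  attained-floor = attain (floor (∁ ∅)) (zero , x , refl) (suc zero , x , refl) mate
      (≤-reflexive (trans (cut-floor n (∁ ∅)) (trans (cong₂ _+_ ∂full≡0 w-full) W≡m+2e)))
    where
    x = proj₁ minimum-degree
    mate : ∀ i x → Mate (floor (∁ ∅)) i x
    mate zero    x = sideways _ zero x (λ _ → refl)
    mate (suc i) x = sideways _ (suc i) x (λ _ → refl)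

  attained-edge : Attained H (2 * ξ + 4)
  attained-edge with x , y , axy , eq ← minimum-edge-degree = attain (floor X) (zero , x , Xx) (suc zero , x , refl) mate
      (≤-trans (≤-reflexive (cut-floor n X)) (≤-trans (∂+w-edge axy)
        (≤-reflexive (trans (cong (2 *_) eq) (*-distribˡ-+ 2 ξ 2)))))
    where
    X = ｛ x ｝ ∪ ｛ y ｝
    Xx : X x ≡ true
    Xx = pair-left x y
    Xy : X y ≡ true
    Xy = pair-right x y
    mate : ∀ i z → Mate (floor X) i z
    mate (suc i) z = sideways _ (suc i) z (λ _ → refl)
    mate zero    z = go (x ≟ z) (y ≟ z)
      where
      go : Dec (x ≡ z) → Dec (y ≡ z) → Mate (floor X) zero z
      go (yes refl) _         = horizontal y axy (trans Xx (sym Xy))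
      go _         (yes refl) = horizontal x (trans (a-sym y x) axy) (trans Xy (sym Xx))
      -- All neighbours of `z` in its own layer may lie in the pair, but the layer above lies
      -- entirely outside the set.
      go (no x≢z)  (no y≢z)   = vertical (suc zero) (link zero) (cong₂ _∨_ (dec-false (x ≟ z) x≢z) (dec-false (y ≟ z) y≢z))

  attained-column : Attained H (5 * δ + 1)
  attained-column = go n refl
    where
    -- Over P₂ there is no third layer, but there 4λ ≤ 4δ makes the cylinder good enough.
    go : ∀ k → k ≡ n → Attained H (5 * δ + 1)
    go zero refl with S , restricted , size≤ ← attained-cylinder =
      S , restricted , ≤-trans size≤ (≤-trans (*-mono-≤ (n≤1+n 4) L≤δ) (m≤m+n _ 1))
    go (suc k) refl with x , refl ← minimum-degree = attain (two-floors ｛ x ｝)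
        (zero , singleton-nonempty x) (suc (suc zero) , x , refl) mate (begin
          cut (two-floors {suc k} ｛ x ｝)                                       ≡⟨ cut-two-floors k ｛ x ｝ ⟩
          ∂ ｛ x ｝ + c ｛ x ｝ ｛ x ｝ + (∂ ｛ x ｝ + w ｛ x ｝)              ≡⟨ cong₂ (λ i j → ∂ ｛ x ｝ + i + (∂ ｛ x ｝ + j)) (c-diagonal ｛ x ｝) (w-singleton x) ⟩
          ∂ ｛ x ｝ + 2 * ∂ ｛ x ｝ + (∂ ｛ x ｝ + suc (deg x))               ≤⟨ +-mono-≤ (+-mono-≤ ∂≤ (*-monoʳ-≤ 2 ∂≤)) (+-monoˡ-≤ (suc (deg x)) ∂≤) ⟩
          deg x + 2 * deg x + (deg x + suc (deg x))                     ≡⟨ total (deg x) ⟩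
          5 * deg x + 1                                                 ∎)
      where
      open ≤-Reasoning
      ∂≤ = ∂-singleton x
      total : ∀ d → d + 2 * d + (d + suc d) ≡ 5 * d + 1
      total = solve-∀
      mate : ∀ i z → Mate (two-floors ｛ x ｝) i z
      mate zero          z = vertical (suc zero) (inj₁ refl) refl
      mate (suc zero)    z = vertical zero (inj₂ refl) refl
      mate (suc (suc i)) z = sideways _ (suc (suc i)) z (λ _ → refl)

  minimum≤size : ∀ S → IsRestrictedEdgeCut H S → minimum ≤ EdgeSet.size S
  minimum≤size S (¬conn , big) = decidable-stable (minimum ≤? EdgeSet.size S)
    (¬¬-map bound (CH.edge-cut⇒¬¬Side S ¬conn))
    where
    open LowerBound L ξ δ 1≤δ L≤δ δ≤deg ξ+2≤deg+deg L≤∂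
    bound : CH.Side S → minimum ≤ EdgeSet.size S
    bound side = begin
      minimum                                                                         ≡⟨ cong (λ k → ((3 * suc (suc n) ∸ 2) * L) ⊓ k ⊓ (2 * ξ + 4) ⊓ (5 * δ + 1)) W≡m+2e ⟨
      ((3 * suc (suc n) ∸ 2) * L) ⊓ W ⊓ (2 * ξ + 4) ⊓ (5 * δ + 1)                     ≤⟨ minimum≤cut (λ i x → B (vertex x , i)) (edge B id inside) (edge (not ∘ B) (cong not) (proj₁ outside , cong not (proj₂ outside))) ⟩
      cut (λ i x → B (vertex x , i))                                                  ≡⟨ size-boundary≡cut B _ (λ _ _ → refl) ⟨
      EdgeSet.size (CH.boundary B)                                                    ≤⟨ boundary≤ ⟩
      EdgeSet.size S                                                                  ∎
      where
      open ≤-Reasoning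
      open CH.Side side
      -- Here restrictedness enters: `u` keeps an edge in `H − S`, and by `closed` its other end
      -- lies on the same side. Stated for `B′` in order to serve both `B` and its complement.
      edge : ∀ B′ → (∀ {u v} → B u ≡ B v → B′ u ≡ B′ v) → (∃ λ u → B′ u ≡ true) → Edge (λ i x → B′ (vertex x , i))
      edge B′ B⇒B′ (u , B′u) with v , uv ← Cuts.at-least-two⇒neighbour (H − S) (big u) =
        edge⇒Edge B′ (proj₁ uv) B′u (trans (sym (B⇒B′ (closed uv))) B′u)

  attained-minimum : Attained H minimum
  attained-minimum = attained-⊓ (attained-⊓ (attained-⊓ attained-cylinder attained-floor) attained-edge) attained-column
    where
    attained-⊓ : ∀ {j k} → Attained H j → Attained H k → Attained H (j ⊓ k)
    attained-⊓ {j} {k} p q with ⊓-sel j k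
    ... | inj₁ e = subst (Attained H) (sym e) p
    ... | inj₂ e = subst (Attained H) (sym e) q

theorem3p1 : (G : Graph) → Graph.Connected G → Graph.Nontrivial G →
    (n : ℕ) → 2 ≤ n →
    (λG ξG δG : ℕ) → IsEdgeConnectivity G λG → IsMinEdgeDegree G ξG → IsMinDegree G δG →
    IsRestrictedEdgeConnectivity (G ⊠ Path n)
    (((3 * n ∸ 2) * λG) ⊓ (Graph.order G + 2 * Graph.e G) ⊓ (2 * ξG + 4) ⊓ (5 * δG + 1))
theorem3p1 G connected nontrivial (suc (suc n)) (s≤s (s≤s _)) L ξ δ isL isξ isδ
  with S , restricted , size≤ ← attained-minimum G connected nontrivial n L ξ δ isL isξ isδ =
    (S , restricted , ≤-antisym size≤ (minimum≤size G connected nontrivial n L ξ δ isL isξ isδ S restricted)) ,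
    minimum≤size G connected nontrivial n L ξ δ isL isξ isδ
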